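{- There is an absolute constant $c>0$ such that for every $d\in\mathbb{N}$ the hypercube $Q_d$ is $\frac{c\,2^d}{d}$-minor-universal. Moreover, there is an absolute constant $C>0$ such that for every $d\in\mathbb{N}$ the hypercube $Q_d$ is not $\frac{C\,2^d}{\sqrt{d}}$-minor-universal.
   Context: All graphs are finite and simple. A graph $H$ is a minor of a graph $G$ ($H\le G$) if a graph isomorphic to $H$ can be obtained from $G$ by repeatedly deleting vertices, deleting edges and contracting edges. For a real number $m$, a graph $G$ is $m$-minor-universal if every graph with at most $m$ edges and with no isolated vertices is a minor of $G$. The $d$-dimensional hypercube $Q_d$ has vertex set $\{0,1\}^d$, two binary strings being adjacent iff they differ in exactly one coordinate. The first assertion is the paper's statement "$Q_d$ is $\Omega(2^d/d)$-minor-universal". -}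

module Defs where

open import Data.Nat using (ℕ; zero; suc; _+_; _*_; _^_; _≤_)
open import Data.Bool using (Bool; true; false; _∧_; _∨_; not; if_then_else_)
open import Data.Fin using (Fin; punchIn; remQuot; _≟_; _<?_)
open import Data.Fin.Permutation using (Permutation′; _⟨$⟩ʳ_)
open import Data.Vec using (Vec; []; _∷_)
open import Data.List using (List; map; allFin)
open import Data.Nat.ListAction using (sum)
open import Data.Product using (Σ; ∃; _×_; _,_; proj₁; proj₂)
open import Relation.Nullary.Decidable using (⌊_⌋)
open import Relation.Binary.PropositionalEquality using (_≡_)

Graph : ℕ → Set
Graph n = Fin n → Fin n → Bool

record IsSimple {n : ℕ} (G : Graph n) : Set where
  field
    sym     : ∀ i j → G i j ≡ G j i
    irrefl  : ∀ i → G i i ≡ false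

_==_ : {n : ℕ} → Fin n → Fin n → Bool
i == j = ⌊ i ≟ j ⌋

edgeCount : {n : ℕ} → Graph n → ℕ
edgeCount {n} G =
  sum (map (λ i → sum (map (λ j → if G i j ∧ ⌊ i <? j ⌋ then 1 else 0) (allFin n))) (allFin n))

NoIsolated : {n : ℕ} → Graph n → Set
NoIsolated {n} G = ∀ (i : Fin n) → ∃ λ (j : Fin n) → G i j ≡ true

deleteVertex : {m : ℕ} → Graph (suc m) → Fin (suc m) → Graph m
deleteVertex G v i j = G (punchIn v i) (punchIn v j)

deleteEdge : {n : ℕ} → Graph n → Fin n → Fin n → Graph n
deleteEdge G u v i j = G i j ∧ not ((i == u ∧ j == v) ∨ (i == v ∧ j == u))

-- Contracting the edge uv: v is merged into u (loops and parallel edges discarded);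
-- remaining vertices relabelled via punchIn v.
contractEdge : {m : ℕ} → Graph (suc m) → Fin (suc m) → Fin (suc m) → Graph m
contractEdge G u v i j =
  not (i == j) ∧
    (G i' j' ∨ ((i' == u) ∧ G v j') ∨ ((j' == u) ∧ G v i'))
  where
    i' = punchIn v i
    j' = punchIn v j

data Step : {n n' : ℕ} → Graph n → Graph n' → Set where
  delV : {m : ℕ} (G : Graph (suc m)) (v : Fin (suc m)) → Step G (deleteVertex G v)
  delE : {n : ℕ} (G : Graph n) (u v : Fin n) → G u v ≡ true → Step G (deleteEdge G u v)
  conE : {m : ℕ} (G : Graph (suc m)) (u v : Fin (suc m)) → G u v ≡ true →
         Step G (contractEdge G u v)

_≅_ : {n : ℕ} → Graph n → Graph n → Set
_≅_ {n} H G = Σ (Permutation′ n) λ σ → ∀ i j → H i j ≡ G (σ ⟨$⟩ʳ i) (σ ⟨$⟩ʳ j)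

data _≼_ : {n m : ℕ} → Graph n → Graph m → Set where
  done : {n : ℕ} {H G : Graph n} → H ≅ G → H ≼ G
  step : {n m m' : ℕ} {H : Graph n} {G : Graph m} {G' : Graph m'} →
         Step G G' → H ≼ G' → H ≼ G

-- Minor-universality with the edge bound given as a predicate on the edge count
-- ("|E(H)| ≤ bound").
MinorUniversal : {m : ℕ} → Graph m → (ℕ → Set) → Set
MinorUniversal G Bound =
  ∀ (n : ℕ) (H : Graph n) → IsSimple H → NoIsolated H → Bound (edgeCount H) → H ≼ G

-- Binary string of a vertex of Q_d, via Fin (2 ^ (suc d)) = Fin (2 * 2 ^ d).
bits : (d : ℕ) → Fin (2 ^ d) → Vec Bool d
bits zero    i = []
bits (suc d) i with remQuot {2} (2 ^ d) i
... | (b , r) = (b == Fin.suc Fin.zero) ∷ bits d r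
  where import Data.Fin as Fin

hamming : {d : ℕ} → Vec Bool d → Vec Bool d → ℕ
hamming []       []       = 0
hamming (x ∷ xs) (y ∷ ys) = (if (x ∧ not y) ∨ (y ∧ not x) then 1 else 0) + hamming xs ys

Q : (d : ℕ) → Graph (2 ^ d)
Q d i j = ⌊ hamming (bits d i) (bits d j) Data.Nat.≟ 1 ⌋
  where import Data.Nat

{-# OPTIONS --safe #-}
module Submission where

-- Universality: listing the ends of the edges of H edge by edge, and sorting that list by vertex,
-- shows that H is a minor of the union of two Hamiltonian paths, hence (Gray code) of the union of
-- Q_k and of an image of Q_k under a permutation π of its vertices, where 2^k ≥ 2|E(H)|. By the
-- Beneš network π is a composition of 2k layers of swaps along edges of Q_k. Each layer is realised
-- by disjoint paths in Q_k × Q_2, and the layers are stacked along a Hamiltonian path of a cube of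
-- dimension about log k, so Q_d with d = k + 2 + O(log k) suffices.
--
-- Non-universality: a minor of Q_d is determined by the contracted edges, the kept edges and one
-- representative per vertex. A list of m edges of Q_d, up to order, is a string of length 2^d + m
-- over an alphabet of d + 1 letters, so there are at most (d+1)^(O(2^d + m)) 2^(dn) labelled minors
-- with m edges and n vertices. For m a large multiple of 2^d / √d this is less than the number of labelled graphs
-- with m edges and about 2m / 9 vertices.

open import Defs
open import Data.Bool using (Bool; true; false; _∧_; _∨_; _xor_; not; if_then_else_)
import Data.Bool.Properties as Bool
open import Data.Fin using (Fin; zero; suc; toℕ; fromℕ<; punchIn; punchOut; opposite; combine; remQuot; funToFin; finToFun; _↑ˡ_; _↑ʳ_)
import Data.Fin as Fin
import Data.Fin.Properties as Fin
open import Data.Fin.Patterns using (0F; 1F)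
open import Data.Fin.Permutation using (Permutation′; permutation; cast-id; _⟨$⟩ʳ_; _⟨$⟩ˡ_)
import Data.Fin.Permutation as Permutation
open import Data.List using (List; []; _∷_; _++_; map; filter; length; lookup; replicate; tabulate; allFin; cartesianProduct)
import Data.List.Properties as List
open import Data.List.Membership.Propositional using (_∈_)
open import Data.List.Membership.Propositional.Properties using (∈-allFin; ∈-cartesianProduct⁺; ∈-filter⁺; ∈-filter⁻; ∈-map⁺; ∈-map⁻; ∈-lookup; ∈-++⁺ˡ; ∈-++⁺ʳ; ∈-++⁻; ∈-tabulate⁺; ∈-tabulate⁻)
import Data.List.Membership.DecPropositional as DecMembership
open import Data.List.Relation.Binary.Permutation.Propositional using (↭⇒↭ₛ)
open import Data.List.Relation.Binary.Permutation.Propositional.Properties using (↭-length)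
import Data.List.Relation.Binary.Permutation.Homogeneous as PermutationHomogeneous
import Data.List.Relation.Binary.Permutation.Setoid.Properties as PermutationSetoidProperties
import Data.List.Relation.Unary.All as All
open import Data.List.Relation.Unary.AllPairs using ([]; _∷_)
open import Data.List.Relation.Unary.Any using (here; there)
import Data.List.Relation.Unary.Any as Any
import Data.List.Relation.Unary.Any.Properties as Any
open import Data.List.Relation.Unary.Sorted.TotalOrder.Properties using (lookup-mono-≤)
open import Data.List.Relation.Unary.Unique.Propositional using (Unique)
import Data.List.Relation.Unary.Unique.Propositional.Properties as Unique
import Data.List.Sort as Sort
open import Data.Maybe using (Maybe; just; nothing; _>>=_)
import Data.Maybe as Maybe
open import Data.Maybe.Properties using (just-injective)
import Data.Maybe.Properties as Maybe
open import Data.Nat using (ℕ; zero; suc; pred; _+_; _*_; _^_; _∸_; _⊓_; _≤_; _<_; z≤n; s≤s; >-nonZero)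
open import Data.Nat.ListAction using (sum)
import Data.Nat.Properties as ℕ
open import Data.Nat.Solver using (module +-*-Solver)
open import Data.Product using (Σ; ∃; ∃₂; _×_; _,_; proj₁; proj₂)
import Data.Product as Product
import Data.Product.Properties as ×
open import Data.Sum using (_⊎_; inj₁; inj₂)
import Data.Sum as Sum
open import Data.Vec using (Vec; []; _∷_)
import Data.Vec as Vec
import Data.Vec.Properties as Vec
open import Function using (_∘_; id; _↔_; Inverse; mk↔ₛ′)
open import Function.Construct.Composition using (_↔-∘_)
open import Function.Construct.Symmetry using (↔-sym)
open import Relation.Binary using (Symmetric; DecTotalOrder; tri<; tri≈; tri>)
open import Relation.Binary.Construct.Closure.ReflexiveTransitive using (Star; ε; _◅_; _◅◅_; reverse)
import Relation.Binary.Construct.Closure.ReflexiveTransitive as Star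
open import Relation.Binary.PropositionalEquality using (_≡_; _≢_; refl; sym; trans; cong; cong₂; subst; subst₂; setoid; module ≡-Reasoning)
open import Relation.Nullary using (¬_; yes; no; contradiction)
open import Relation.Nullary.Decidable using (⌊_⌋; _×-dec_)

open +-*-Solver using (solve; _:+_; _:*_; _:=_; con)
open Inverse using (to; from; strictlyInverseˡ; strictlyInverseʳ)

-- Minor models

-- Sorting makes the occurrences of a vertex of $H$ an interval of one path, while in the other path
-- the two ends of each edge are neighbours; matching the two orders is an arbitrary permutation.
-- The obstacle in routing it is that two tokens exchanged along a cube edge need vertex-disjoint
-- paths; the factor $Q_2$, a 4-cycle of ports at each vertex and time, makes room for them. The
-- ports contribute a factor 4 and the two ends per edge a factor 2, whence the constant 32. In the
-- counting argument, naming each edge by its vertices would cost about as many bits as a free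
-- choice brings. Representatives still cost $d$ bits per vertex, so the graphs counted need many
-- more free choices than vertices: eight choices per left vertex, against two vertices.

Within : {V X : Set} → (X → X → Set) → (X → Maybe V) → V → X → X → Set
Within G φ v x y = G x y × φ x ≡ just v × φ y ≡ just v

within-sym : {V X : Set} {G : X → X → Set} {φ : X → Maybe V} {v : V} →
             Symmetric G → Symmetric (Within G φ v)
within-sym G-sym (g , p , q) = G-sym g , q , p

record Model {V X : Set} (H : V → V → Set) (G : X → X → Set) : Set where
  field
    φ      : X → Maybe V
    root   : V → X
    φ-root : ∀ v → φ (root v) ≡ just v
    conn   : ∀ {x v} → φ x ≡ just v → Star (Within G φ v) (root v) x
    edge   : ∀ {u v} → H u v → ∃₂ λ x y → φ x ≡ just u × φ y ≡ just v × G x y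

-- Branch sets compose as partial maps. An edge of `K` inside a branch set of `M` becomes a walk in
-- `G`: from one root to the realising edge, across it, and back to the other root. The way back
-- needs the symmetry of `G`.
model-trans : {V X Y : Set} {H : V → V → Set} {K : X → X → Set} {G : Y → Y → Set} →
              Symmetric G → Model H K → Model K G → Model H G
model-trans {V} {X} {Y} {H} {K} {G} G-sym M N = record
  { φ      = φ
  ; root   = N.root ∘ M.root
  ; φ-root = λ v → trans (cong (_>>= M.φ) (N.φ-root (M.root v))) (M.φ-root v)
  ; conn   = conn
  ; edge   = edge
  }
  where
  module M = Model M
  module N = Model N

  φ : Y → Maybe V
  φ y = N.φ y >>= M.φ

  φ-via : ∀ {y x v} → N.φ y ≡ just x → M.φ x ≡ just v → φ y ≡ just v
  φ-via p q = trans (cong (_>>= M.φ) p) q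

  coarsen : ∀ {x v} → M.φ x ≡ just v → ∀ {a b} → Within G N.φ x a b → Within G φ v a b
  coarsen q (g , p , p′) = g , φ-via p q , φ-via p′ q

  lift : ∀ {v a b} → Within K M.φ v a b → Star (Within G φ v) (N.root a) (N.root b)
  lift {v} {a} {b} (k , pa , pb) with N.edge k
  ... | x , y , px , py , g =
    Star.map (coarsen pa) (N.conn px) ◅◅
    (g , φ-via px pa , φ-via py pb) ◅
    reverse (within-sym {φ = φ} G-sym) (Star.map (coarsen pb) (N.conn py))

  conn : ∀ {y v} → φ y ≡ just v → Star (Within G φ v) (N.root (M.root v)) y
  conn {y} {v} p with N.φ y in eq
  ... | just x  = Star.concat (Star.gmap N.root lift (M.conn p)) ◅◅ Star.map (coarsen p) (N.conn eq)

  edge : ∀ {u v} → H u v → ∃₂ λ x y → φ x ≡ just u × φ y ≡ just v × G x y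
  edge h with M.edge h
  ... | a , b , pa , pb , k with N.edge k
  ... | x , y , px , py , g = x , y , φ-via px pa , φ-via py pb , g

-- From models to sequences of deletions and contractions

Edge : {n : ℕ} → Graph n → Fin n → Fin n → Set
Edge G i j = G i j ≡ true

==-refl : {n : ℕ} (i : Fin n) → (i == i) ≡ true
==-refl i with i Fin.≟ i
... | yes _  = refl
... | no i≢i = contradiction refl i≢i

≢⇒== : {n : ℕ} {i j : Fin n} → i ≢ j → (i == j) ≡ false
≢⇒== {i = i} {j} i≢j with i Fin.≟ j
... | yes i≡j = contradiction i≡j i≢j
... | no _    = refl

==⇒≡ : {n : ℕ} {i j : Fin n} → (i == j) ≡ true → i ≡ j
==⇒≡ {i = i} {j} p with i Fin.≟ j
... | yes i≡j = i≡j

edge-sym : {n : ℕ} {G : Graph n} → IsSimple G → Symmetric (Edge G)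
edge-sym s {i} {j} = trans (IsSimple.sym s j i)

deleteVertex-simple : {m : ℕ} {G : Graph (suc m)} (v : Fin (suc m)) → IsSimple G → IsSimple (deleteVertex G v)
deleteVertex-simple v s = record
  { sym    = λ i j → IsSimple.sym s _ _
  ; irrefl = λ i → IsSimple.irrefl s _ }

deleteEdge-simple : {m : ℕ} {G : Graph m} (u v : Fin m) → IsSimple G → IsSimple (deleteEdge G u v)
deleteEdge-simple u v s = record
  { sym    = λ i j → cong₂ (λ a b → a ∧ not b) (IsSimple.sym s i j)
      (trans (Bool.∨-comm (i == u ∧ j == v) _)
             (cong₂ _∨_ (Bool.∧-comm (i == v) _) (Bool.∧-comm (i == u) _)))
  ; irrefl = λ i → cong (_∧ _) (IsSimple.irrefl s i) }

==-comm : {n : ℕ} (i j : Fin n) → (i == j) ≡ (j == i)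
==-comm i j with i Fin.≟ j
... | yes refl = sym (==-refl i)
... | no i≢j   = sym (≢⇒== (i≢j ∘ sym))

contractEdge-simple : {m : ℕ} {G : Graph (suc m)} (u v : Fin (suc m)) → IsSimple G → IsSimple (contractEdge G u v)
contractEdge-simple {G = G} u v s = record
  { sym    = λ i j → cong₂ _∧_ (cong not (==-comm i j))
                       (cong₂ _∨_ (IsSimple.sym s _ _) (Bool.∨-comm (punchIn v i == u ∧ G v (punchIn v j)) _))
  ; irrefl = λ i → cong₂ _∧_ (cong not (==-refl i)) refl }

module Contraction {m : ℕ} {u v : Fin (suc m)} (v≢u : v ≢ u) where

  -- The quotient map of the contraction, with section `punchIn v`: both `u` and `v` go to the new
  -- label of `u`.
  proj : Fin (suc m) → Fin m
  proj a with v Fin.≟ a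
  ... | yes _  = punchOut v≢u
  ... | no v≢a = punchOut v≢a

  proj-v : proj v ≡ punchOut v≢u
  proj-v with v Fin.≟ v
  ... | yes _  = refl
  ... | no v≢v = contradiction refl v≢v

  proj-punchIn : ∀ a → proj (punchIn v a) ≡ a
  proj-punchIn a with v Fin.≟ punchIn v a
  ... | yes v≡ = contradiction (sym v≡) (Fin.punchInᵢ≢i v a)
  ... | no v≢  = trans (Fin.punchOut-cong v refl) (Fin.punchOut-punchIn v)

  proj-u : proj u ≡ punchOut v≢u
  proj-u = trans (cong proj (sym (Fin.punchIn-punchOut v≢u))) (proj-punchIn _)

  punchIn-proj : ∀ a → (a ≡ v × punchIn v (proj a) ≡ u) ⊎ (punchIn v (proj a) ≡ a)
  punchIn-proj a with v Fin.≟ a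
  ... | yes v≡a = inj₁ (sym v≡a , Fin.punchIn-punchOut v≢u)
  ... | no v≢a  = inj₂ (Fin.punchIn-punchOut v≢a)

  contractEdge-proj : (G : Graph (suc m)) → IsSimple G → ∀ {a b} → Edge G a b →
                      proj a ≡ proj b ⊎ Edge (contractEdge G u v) (proj a) (proj b)
  contractEdge-proj G s {a} {b} g with proj a Fin.≟ proj b
  ... | yes eq = inj₁ eq
  ... | no neq = inj₂ (disj (punchIn-proj a) (punchIn-proj b))
    where
    disj : ((a ≡ v × punchIn v (proj a) ≡ u) ⊎ (punchIn v (proj a) ≡ a)) →
           ((b ≡ v × punchIn v (proj b) ≡ u) ⊎ (punchIn v (proj b) ≡ b)) →
           (G (punchIn v (proj a)) (punchIn v (proj b)) ∨
           ((punchIn v (proj a) == u) ∧ G v (punchIn v (proj b))) ∨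
           ((punchIn v (proj b) == u) ∧ G v (punchIn v (proj a)))) ≡ true
    disj (inj₁ (refl , p)) (inj₁ (refl , q)) = contradiction refl neq
    disj (inj₁ (refl , p)) (inj₂ q) rewrite p | q | ==-refl u | g = Bool.∨-zeroʳ (G u b)
    disj (inj₂ p) (inj₁ (refl , q)) rewrite p | q | ==-refl u | edge-sym {G = G} s g =
      trans (cong (G a u ∨_) (Bool.∨-zeroʳ _)) (Bool.∨-zeroʳ (G a u))
    disj (inj₂ p) (inj₂ q) rewrite p | q | g = refl

⟨$⟩ʳ-injective : ∀ {n} (σ : Permutation′ n) {i j} → σ ⟨$⟩ʳ i ≡ σ ⟨$⟩ʳ j → i ≡ j
⟨$⟩ʳ-injective σ p =
  trans (sym (Permutation.inverseˡ σ)) (trans (cong (σ ⟨$⟩ˡ_) p) (Permutation.inverseˡ σ))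

-- Induction on `L`, a list of candidates for the surplus edges of `G`. Non-edges and edges of `H`
-- in it are skipped, so the list of all pairs can serve as the start.
spanning⇒≼ : {n : ℕ} {H G : Graph n} → IsSimple H → IsSimple G →
             (σ : Permutation′ n) → (∀ {i j} → Edge H i j → Edge G (σ ⟨$⟩ʳ i) (σ ⟨$⟩ʳ j)) →
             (L : List (Fin n × Fin n)) →
             (∀ i j → Edge G (σ ⟨$⟩ʳ i) (σ ⟨$⟩ʳ j) → H i j ≡ false → (i , j) ∈ L) → H ≼ G
spanning⇒≼ {n} {H} {G} sH sG σ H⊆G [] extra = done (σ , same)
  where
  same : ∀ i j → H i j ≡ G (σ ⟨$⟩ʳ i) (σ ⟨$⟩ʳ j)
  same i j with H i j in h | G (σ ⟨$⟩ʳ i) (σ ⟨$⟩ʳ j) in g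
  ... | true  | true  = refl
  ... | false | false = refl
  ... | true  | false = trans (sym (H⊆G h)) g
  ... | false | true  with () ← extra i j g h
spanning⇒≼ {n} {H} {G} sH sG σ H⊆G ((a , b) ∷ L) extra
  with G (σ ⟨$⟩ʳ a) (σ ⟨$⟩ʳ b) in g | H a b in h
... | true | false = step (delE G sa sb g)
        (spanning⇒≼ sH (deleteEdge-simple sa sb sG) σ H⊆G′ L extra′)
  where
  sa = σ ⟨$⟩ʳ a
  sb = σ ⟨$⟩ʳ b
  kept : ∀ {i j} → ¬ ((i , j) ≡ (a , b)) → ¬ ((i , j) ≡ (b , a)) →
         not (((σ ⟨$⟩ʳ i) == sa ∧ (σ ⟨$⟩ʳ j) == sb) ∨ ((σ ⟨$⟩ʳ i) == sb ∧ (σ ⟨$⟩ʳ j) == sa)) ≡ true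
  kept {i} {j} ne ne′ with (σ ⟨$⟩ʳ i) Fin.≟ sa | (σ ⟨$⟩ʳ j) Fin.≟ sb | (σ ⟨$⟩ʳ i) Fin.≟ sb | (σ ⟨$⟩ʳ j) Fin.≟ sa
  ... | yes p | yes q | _ | _ = contradiction (cong₂ _,_ (⟨$⟩ʳ-injective σ p) (⟨$⟩ʳ-injective σ q)) ne
  ... | _ | _ | yes p | yes q = contradiction (cong₂ _,_ (⟨$⟩ʳ-injective σ p) (⟨$⟩ʳ-injective σ q)) ne′
  ... | no _ | _ | no _ | _ = refl
  ... | no _ | _ | yes _ | no _ = refl
  ... | yes _ | no _ | no _ | _ = refl
  ... | yes _ | no _ | yes _ | no _ = refl
  H⊆G′ : ∀ {i j} → Edge H i j → Edge (deleteEdge G sa sb) (σ ⟨$⟩ʳ i) (σ ⟨$⟩ʳ j)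
  H⊆G′ {i} {j} e = cong₂ _∧_ (H⊆G e) (kept
     (λ { refl → contradiction (trans (sym e) h) λ () })
     (λ { refl → contradiction (trans (sym e) (trans (IsSimple.sym sH _ _) h)) λ () }))
  extra′ : ∀ i j → Edge (deleteEdge G sa sb) (σ ⟨$⟩ʳ i) (σ ⟨$⟩ʳ j) → H i j ≡ false → (i , j) ∈ L
  extra′ i j g′ h′ with G (σ ⟨$⟩ʳ i) (σ ⟨$⟩ʳ j) in gij
  ... | true with extra i j gij h′
  ...   | there p = p
  ...   | here refl rewrite ==-refl sa | ==-refl sb with () ← g′
... | true | true = spanning⇒≼ sH sG σ H⊆G L extra′
  where
  extra′ : ∀ i j → Edge G (σ ⟨$⟩ʳ i) (σ ⟨$⟩ʳ j) → H i j ≡ false → (i , j) ∈ L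
  extra′ i j g′ h′ with extra i j g′ h′
  ... | there p   = p
  ... | here refl = contradiction (trans (sym h) h′) λ ()
... | false | _ = spanning⇒≼ sH sG σ H⊆G L extra′
  where
  extra′ : ∀ i j → Edge G (σ ⟨$⟩ʳ i) (σ ⟨$⟩ʳ j) → H i j ≡ false → (i , j) ∈ L
  extra′ i j g′ h′ with extra i j g′ h′
  ... | there p   = p
  ... | here refl = contradiction (trans (sym g) g′) λ ()

module _ {n : ℕ} {H : Graph n} (sH : IsSimple H) where

  -- With no host edge inside a branch set, the walk given by `conn` is empty, so each branch set is
  -- just its root. Roots and labels are then mutually inverse, and only surplus edges remain to be
  -- deleted.
  bijective⇒≼ : {m : ℕ} {G : Graph m} → IsSimple G → (M : Model (Edge H) (Edge G)) →
                (∀ x → Model.φ M x ≢ nothing) →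
                (∀ x y → Edge G x y → Model.φ M x ≢ Model.φ M y) → H ≼ G
  bijective⇒≼ {m} {G} sG M total indep = finish m≡n sG M total indep
    where
    label : ∀ {m} {G : Graph m} (M : Model (Edge H) (Edge G)) → (∀ x → Model.φ M x ≢ nothing) →
            ∀ x → ∃ λ v → Model.φ M x ≡ just v
    label M total x with Model.φ M x in eq
    ... | just v  = v , refl
    ... | nothing = contradiction eq (total x)

    root-label : ∀ {m} {G : Graph m} (M : Model (Edge H) (Edge G)) →
                 (∀ x y → Edge G x y → Model.φ M x ≢ Model.φ M y) →
                 ∀ {x v} → Model.φ M x ≡ just v → Model.root M v ≡ x
    root-label M indep p with Model.conn M p
    ... | ε = refl
    ... | (g , a , b) ◅ _ = contradiction (trans a (sym b)) (indep _ _ g)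

    m≡n : m ≡ n
    m≡n = Fin.cantor-schröder-bernstein
      {f = λ x → proj₁ (label M total x)} {g = Model.root M}
      (λ {x} {y} p → trans (sym (root-label M indep (proj₂ (label M total x))))
        (trans (cong (Model.root M) p) (root-label M indep (proj₂ (label M total y)))))
      (λ {u} {v} p → just-injective (trans (sym (Model.φ-root M u)) (trans (cong (Model.φ M) p) (Model.φ-root M v))))

    finish : ∀ {m} {G : Graph m} → m ≡ n → IsSimple G → (M : Model (Edge H) (Edge G)) →
             (∀ x → Model.φ M x ≢ nothing) →
             (∀ x y → Edge G x y → Model.φ M x ≢ Model.φ M y) → H ≼ G
    finish {G = G} refl sG M total indep =
      spanning⇒≼ sH sG σ H⊆G (cartesianProduct (allFin n) (allFin n))
        (λ i j _ _ → ∈-cartesianProduct⁺ (∈-allFin i) (∈-allFin j))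
      where
      σ : Permutation′ n
      σ = permutation (Model.root M) (λ x → proj₁ (label M total x))
        (λ x → root-label M indep (proj₂ (label M total x)))
        (λ v → just-injective (trans (sym (proj₂ (label M total (Model.root M v)))) (Model.φ-root M v)))
      H⊆G : ∀ {i j} → Edge H i j → Edge G (Model.root M i) (Model.root M j)
      H⊆G e with Model.edge M e
      ... | x , y , p , q , g = trans (cong₂ G (root-label M indep p) (root-label M indep q)) g

  model-deleteVertex : {m : ℕ} {G : Graph (suc m)} (M : Model (Edge H) (Edge G)) →
                       ∀ x → Model.φ M x ≡ nothing → Model (Edge H) (Edge (deleteVertex G x))
  model-deleteVertex {m} {G} M x unused = record
    { φ      = φ ∘ punchIn x
    ; root   = root′
    ; φ-root = λ v → trans (cong φ (Fin.punchIn-punchOut (used (φ-root v)))) (φ-root v)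
    ; conn   = conn′
    ; edge   = edge′
    }
    where
    open Model M
    used : ∀ {a v} → φ a ≡ just v → x ≢ a
    used p refl = contradiction (trans (sym unused) p) λ ()
    root′ : Fin n → Fin m
    root′ v = punchOut (used (φ-root v))
    G′ = deleteVertex G x

    restrict : ∀ {v a b} → Star (Within (Edge G) φ v) a b → (p : x ≢ a) (q : x ≢ b) →
               Star (Within (Edge G′) (φ ∘ punchIn x) v) (punchOut p) (punchOut q)
    restrict {v} ε p q = subst (Star _ (punchOut p)) (Fin.punchOut-cong x refl) ε
    restrict {v} {a} {b} (_◅_ {j = c} (g , pa , pc) s) p q =
      (trans (cong₂ G (Fin.punchIn-punchOut p) (Fin.punchIn-punchOut r)) g
        , trans (cong φ (Fin.punchIn-punchOut p)) pa , trans (cong φ (Fin.punchIn-punchOut r)) pc)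
      ◅ restrict s r q
      where r = used pc

    conn′ : ∀ {a v} → φ (punchIn x a) ≡ just v → Star (Within (Edge G′) (φ ∘ punchIn x) v) (root′ v) a
    conn′ {a} {v} p = subst (Star _ (root′ v)) (trans (Fin.punchOut-cong x refl) (Fin.punchOut-punchIn x))
      (restrict (conn p) (used (φ-root v)) (used p))

    edge′ : ∀ {u v} → Edge H u v → ∃₂ λ a b → φ (punchIn x a) ≡ just u × φ (punchIn x b) ≡ just v × Edge G′ a b
    edge′ h with edge h
    ... | a , b , pa , pb , g = punchOut (used pa) , punchOut (used pb)
          , trans (cong φ (Fin.punchIn-punchOut (used pa))) pa
          , trans (cong φ (Fin.punchIn-punchOut (used pb))) pb
          , trans (cong₂ G (Fin.punchIn-punchOut (used pa)) (Fin.punchIn-punchOut (used pb))) g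

  model-contractEdge : {m : ℕ} {G : Graph (suc m)} → IsSimple G → (M : Model (Edge H) (Edge G)) →
                       ∀ x y → Edge G x y → Model.φ M x ≡ Model.φ M y →
                       Model (Edge H) (Edge (contractEdge G x y))
  model-contractEdge {m} {G} sG M x y gxy same = record
    { φ      = φ′
    ; root   = proj ∘ root
    ; φ-root = λ v → trans (φ-proj (root v)) (φ-root v)
    ; conn   = λ {a} {v} p → subst (Star _ (proj (root v))) (proj-punchIn a) (project (conn p))
    ; edge   = edge′
    }
    where
    open Model M
    y≢x : y ≢ x
    y≢x refl = contradiction (trans (sym gxy) (IsSimple.irrefl sG x)) λ ()
    open Contraction y≢x
    φ′ = φ ∘ punchIn y
    G′ = contractEdge G x y
    φ-proj : ∀ a → φ′ (proj a) ≡ φ a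
    φ-proj a with punchIn-proj a
    ... | inj₁ (refl , p) = trans (cong φ p) same
    ... | inj₂ p          = cong φ p

    project : ∀ {v a b} → Star (Within (Edge G) φ v) a b → Star (Within (Edge G′) φ′ v) (proj a) (proj b)
    project ε = ε
    project {v} {a} {b} (_◅_ {j = c} (g , pa , pc) s) with contractEdge-proj G sG g
    ... | inj₁ eq = subst (λ z → Star _ z (proj b)) (sym eq) (project s)
    ... | inj₂ g′ = (g′ , trans (φ-proj a) pa , trans (φ-proj c) pc) ◅ project s

    edge′ : ∀ {u v} → Edge H u v → ∃₂ λ a b → φ′ a ≡ just u × φ′ b ≡ just v × Edge G′ a b
    edge′ {u} {v} h with edge h
    ... | a , b , pa , pb , g with contractEdge-proj G sG g
    ...   | inj₂ g′ = proj a , proj b , trans (φ-proj a) pa , trans (φ-proj b) pb , g′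
    -- If the edge collapsed, its two ends would carry the same label, and `H` would have a loop.
    ...   | inj₁ eq = contradiction (trans (sym h) (trans (cong (H u) (sym u≡v)) (IsSimple.irrefl sH u))) λ ()
      where
      u≡v : u ≡ v
      u≡v = just-injective (trans (sym pa) (trans (sym (φ-proj a)) (trans (cong φ′ eq) (trans (φ-proj b) pb))))

  model⇒≼ : {m : ℕ} {G : Graph m} → IsSimple G → Model (Edge H) (Edge G) → H ≼ G
  model⇒≼ {zero}  sG M = bijective⇒≼ sG M (λ ()) (λ ())
  model⇒≼ {suc m} {G} sG M with Fin.any? (λ x → Maybe.≡-dec Fin._≟_ (Model.φ M x) nothing)
  ... | yes (x , unused) = step (delV G x) (model⇒≼ (deleteVertex-simple x sG) (model-deleteVertex M x unused))
  ... | no total with Fin.any? (λ x → Fin.any? (λ y → (G x y Bool.≟ true) ×-dec Maybe.≡-dec Fin._≟_ (Model.φ M x) (Model.φ M y)))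
  ...   | yes (x , y , g , same) =
            step (conE G x y g) (model⇒≼ (contractEdge-simple x y sG) (model-contractEdge sG M x y g same))
  ...   | no indep = bijective⇒≼ sG M (λ x p → total (x , p)) (λ x y g p → indep (x , y , g , p))

-- Hypercubes and Gray codes

Word : ℕ → Set
Word = Vec Bool

data Adj : {d : ℕ} → Word d → Word d → Set where
  flip : ∀ {d b} {w : Word d} → Adj (b ∷ w) (not b ∷ w)
  keep : ∀ {d b} {w w′ : Word d} → Adj w w′ → Adj (b ∷ w) (b ∷ w′)

adj-sym : ∀ {d} → Symmetric (Adj {d})
adj-sym {x = b ∷ w} flip = subst (λ b′ → Adj (not b ∷ w) (b′ ∷ w)) (Bool.not-involutive b) flip
adj-sym (keep a) = keep (adj-sym a)

adj-++ˡ : ∀ {k l} {v v′ : Word k} (w : Word l) → Adj v v′ → Adj (v Vec.++ w) (v′ Vec.++ w)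
adj-++ˡ w flip     = flip
adj-++ˡ w (keep a) = keep (adj-++ˡ w a)

adj-++ʳ : ∀ {k l} (v : Word k) {w w′ : Word l} → Adj w w′ → Adj (v Vec.++ w) (v Vec.++ w′)
adj-++ʳ []      a = a
adj-++ʳ (b ∷ v) a = keep (adj-++ʳ v a)

hamming-refl : ∀ {d} (w : Word d) → hamming w w ≡ 0
hamming-refl []          = refl
hamming-refl (true ∷ w)  = hamming-refl w
hamming-refl (false ∷ w) = hamming-refl w

hamming-sym : ∀ {d} (v w : Word d) → hamming v w ≡ hamming w v
hamming-sym []      []      = refl
hamming-sym (b ∷ v) (c ∷ w) =
  cong₂ (λ x y → (if x then 1 else 0) + y) (Bool.∨-comm (b ∧ not c) _) (hamming-sym v w)

hamming≡0⇒≡ : ∀ {d} (v w : Word d) → hamming v w ≡ 0 → v ≡ w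
hamming≡0⇒≡ []          []          p = refl
hamming≡0⇒≡ (true ∷ v)  (true ∷ w)  p = cong (true ∷_) (hamming≡0⇒≡ v w p)
hamming≡0⇒≡ (false ∷ v) (false ∷ w) p = cong (false ∷_) (hamming≡0⇒≡ v w p)

adj⇒hamming≡1 : ∀ {d} {v w : Word d} → Adj v w → hamming v w ≡ 1
adj⇒hamming≡1 (flip {b = true}  {w}) = cong suc (hamming-refl w)
adj⇒hamming≡1 (flip {b = false} {w}) = cong suc (hamming-refl w)
adj⇒hamming≡1 (keep {b = true}  a)   = adj⇒hamming≡1 a
adj⇒hamming≡1 (keep {b = false} a)   = adj⇒hamming≡1 a

hamming≡1⇒adj : ∀ {d} (v w : Word d) → hamming v w ≡ 1 → Adj v w
hamming≡1⇒adj []          []          ()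
hamming≡1⇒adj (true ∷ v)  (true ∷ w)  p = keep (hamming≡1⇒adj v w p)
hamming≡1⇒adj (false ∷ v) (false ∷ w) p = keep (hamming≡1⇒adj v w p)
hamming≡1⇒adj (true ∷ v)  (false ∷ w) p rewrite hamming≡0⇒≡ v w (ℕ.suc-injective p) = flip
hamming≡1⇒adj (false ∷ v) (true ∷ w)  p rewrite hamming≡0⇒≡ v w (ℕ.suc-injective p) = flip

bit : Bool → Fin 2
bit true  = 1F
bit false = 0F

bit-== : ∀ b → (bit b == 1F) ≡ b
bit-== true  = refl
bit-== false = refl

==-bit : ∀ i → bit (i == 1F) ≡ i
==-bit 0F = refl
==-bit 1F = refl

unbits : (d : ℕ) → Word d → Fin (2 ^ d)
unbits zero    []      = 0F
unbits (suc d) (b ∷ w) = combine (bit b) (unbits d w)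

bits-unbits : ∀ d w → bits d (unbits d w) ≡ w
bits-unbits zero    []      = refl
bits-unbits (suc d) (b ∷ w) = trans
  (cong (λ br → (proj₁ br == 1F) ∷ bits d (proj₂ br)) (Fin.remQuot-combine (bit b) (unbits d w)))
  (cong₂ _∷_ (bit-== b) (bits-unbits d w))

unbits-bits : ∀ d i → unbits d (bits d i) ≡ i
unbits-bits zero    0F = refl
unbits-bits (suc d) i = trans
  (cong₂ combine (==-bit (proj₁ (remQuot {2} (2 ^ d) i))) (unbits-bits d _)) (Fin.combine-remQuot {2} (2 ^ d) i)

words : ∀ d → Word d ↔ Fin (2 ^ d)
words d = mk↔ₛ′ (unbits d) (bits d) (unbits-bits d) (bits-unbits d)

Q-edge⇒adj : ∀ d {i j} → Edge (Q d) i j → Adj (bits d i) (bits d j)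
Q-edge⇒adj d {i} {j} p with hamming (bits d i) (bits d j) ℕ.≟ 1
... | yes q = hamming≡1⇒adj _ _ q

adj⇒Q-edge : ∀ d {i j} → Adj (bits d i) (bits d j) → Edge (Q d) i j
adj⇒Q-edge d {i} {j} a with hamming (bits d i) (bits d j) ℕ.≟ 1
... | yes _ = refl
... | no ¬p = contradiction (adj⇒hamming≡1 a) ¬p

Q-simple : ∀ d → IsSimple (Q d)
Q-simple d = record { sym = Q-sym ; irrefl = Q-irrefl }
  where
  Q-sym : ∀ i j → Q d i j ≡ Q d j i
  Q-sym i j rewrite hamming-sym (bits d i) (bits d j) = refl
  Q-irrefl : ∀ i → Q d i i ≡ false
  Q-irrefl i rewrite hamming-refl (bits d i) = refl

Consecutive : {n : ℕ} → Fin n → Fin n → Set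
Consecutive i j = toℕ j ≡ suc (toℕ i) ⊎ toℕ i ≡ suc (toℕ j)

-- The second half of the reflected Gray code runs through the smaller code backwards.
reflected : ∀ {n} → Fin 2 → Fin n → Fin n
reflected 0F r = r
reflected 1F r = opposite r

reflected-involutive : ∀ {n} b (r : Fin n) → reflected b (reflected b r) ≡ r
reflected-involutive 0F r = refl
reflected-involutive 1F r = Fin.opposite-involutive r

gray′ : ∀ d → Fin (2 ^ d) → Word d
gray′ zero    i = []
gray′ (suc d) i = (proj₁ br == 1F) ∷ gray′ d (reflected (proj₁ br) (proj₂ br))
  where br = remQuot {2} (2 ^ d) i

ungray : ∀ d → Word d → Fin (2 ^ d)
ungray zero    []      = 0F
ungray (suc d) (b ∷ w) = combine (bit b) (reflected (bit b) (ungray d w))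

gray-ungray : ∀ d w → gray′ d (ungray d w) ≡ w
gray-ungray zero    []      = refl
gray-ungray (suc d) (b ∷ w) = trans
  (cong (λ br → (proj₁ br == 1F) ∷ gray′ d (reflected (proj₁ br) (proj₂ br)))
    (Fin.remQuot-combine (bit b) (reflected (bit b) (ungray d w))))
  (cong₂ _∷_ (bit-== b) (trans (cong (gray′ d) (reflected-involutive (bit b) (ungray d w))) (gray-ungray d w)))

ungray-gray : ∀ d i → ungray d (gray′ d i) ≡ i
ungray-gray zero    0F = refl
ungray-gray (suc d) i = trans
  (cong₂ combine (==-bit b) (trans
    (cong₂ reflected (==-bit b) (ungray-gray d (reflected b r))) (reflected-involutive b r)))
  (Fin.combine-remQuot {2} (2 ^ d) i)
  where
  b = proj₁ (remQuot {2} (2 ^ d) i)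
  r = proj₂ (remQuot {2} (2 ^ d) i)

opposite-suc : ∀ {n} {i j : Fin n} → toℕ j ≡ suc (toℕ i) → toℕ (opposite i) ≡ suc (toℕ (opposite j))
opposite-suc {n} {i} {j} p = begin
  toℕ (opposite i)            ≡⟨ Fin.opposite-prop i ⟩
  n ∸ suc (toℕ i)             ≡⟨ cong (n ∸_) p ⟨
  n ∸ toℕ j                   ≡⟨ ℕ.+-∸-assoc 1 (Fin.toℕ<n j) ⟩
  suc (n ∸ suc (toℕ j))       ≡⟨ cong suc (Fin.opposite-prop j) ⟨
  suc (toℕ (opposite j))      ∎
  where open ≡-Reasoning

gray-step : ∀ d {i j} → toℕ j ≡ suc (toℕ i) → Adj (gray′ d i) (gray′ d j)
gray-step zero {0F} {0F} ()
gray-step (suc d) {i} {j} p = go (proj₁ (rq i)) (proj₁ (rq j)) (trans (sym (toℕ-rq j)) (trans p (cong suc (toℕ-rq i))))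
  where
  N = 2 ^ d
  rq = remQuot {2} N
  r  = proj₂ (rq i)
  r′ = proj₂ (rq j)
  toℕ-rq : ∀ i → toℕ i ≡ N * toℕ (proj₁ (rq i)) + toℕ (proj₂ (rq i))
  toℕ-rq i = trans (cong toℕ (sym (Fin.combine-remQuot {2} N i))) (Fin.toℕ-combine (proj₁ (rq i)) _)
  go : ∀ b b′ → N * toℕ b′ + toℕ r′ ≡ suc (N * toℕ b + toℕ r) →
       Adj ((b == 1F) ∷ gray′ d (reflected b r)) ((b′ == 1F) ∷ gray′ d (reflected b′ r′))
  go 0F 0F q rewrite ℕ.*-zeroʳ N = keep (gray-step d q)
  go 1F 1F q = keep (adj-sym (gray-step d (opposite-suc
    (ℕ.+-cancelˡ-≡ (N * 1) _ _ (trans q (sym (ℕ.+-suc (N * 1) (toℕ r))))))))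
  -- The step across the middle: `q` forces `r` to be the last position and `r′` the first.
  -- Reflection gives both the same tail, so only the leading bit changes.
  go 0F 1F q rewrite ℕ.*-zeroʳ N | ℕ.*-identityʳ N = subst (λ z → Adj (false ∷ gray′ d z) (true ∷ gray′ d (opposite r′))) (sym eq) flip
    where
    r′≡0 : toℕ r′ ≡ 0
    r′≡0 = ℕ.n≤0⇒n≡0 (ℕ.+-cancelˡ-≤ N _ _ (ℕ.≤-trans (ℕ.≤-reflexive q) (ℕ.≤-trans (Fin.toℕ<n r) (ℕ.m≤m+n N 0))))
    eq : r ≡ opposite r′
    eq = Fin.toℕ-injective (ℕ.suc-injective (begin
      suc (toℕ r)               ≡⟨ q ⟨
      N + toℕ r′                ≡⟨ cong (N +_) r′≡0 ⟩
      N + 0                     ≡⟨ ℕ.+-identityʳ N ⟩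
      N ∸ 0                     ≡⟨ cong (N ∸_) r′≡0 ⟨
      N ∸ toℕ r′                ≡⟨ ℕ.+-∸-assoc 1 (Fin.toℕ<n r′) ⟩
      suc (N ∸ suc (toℕ r′))    ≡⟨ cong suc (Fin.opposite-prop r′) ⟨
      suc (toℕ (opposite r′))   ∎))
      where open ≡-Reasoning
  go 1F 0F q rewrite ℕ.*-zeroʳ N | ℕ.*-identityʳ N =
    contradiction (Fin.toℕ<n r′) (ℕ.≤⇒≯ (ℕ.≤-trans (ℕ.m≤m+n N (toℕ r)) (ℕ.≤-trans (ℕ.n≤1+n _) (ℕ.≤-reflexive (sym q)))))

gray : ∀ d → Fin (2 ^ d) ↔ Word d
gray d = mk↔ₛ′ (gray′ d) (ungray d) (gray-ungray d) (ungray-gray d)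

gray-consecutive : ∀ d {i j} → Consecutive i j → Adj (to (gray d) i) (to (gray d) j)
gray-consecutive d (inj₁ p) = gray-step d p
gray-consecutive d (inj₂ p) = adj-sym (gray-step d p)

spanning-model : {X Y : Set} {H : X → X → Set} {G : Y → Y → Set} (f : X ↔ Y) →
                 (∀ {x x′} → H x x′ → G (to f x) (to f x′)) → Model H G
spanning-model {X} {Y} {H} {G} f hom = record
  { φ      = just ∘ from f
  ; root   = to f
  ; φ-root = λ x → cong just (strictlyInverseʳ f x)
  ; conn   = λ {y} p → subst (Star _ _) (trans (cong (to f) (sym (just-injective p))) (strictlyInverseˡ f y)) ε
  ; edge   = λ {x} {x′} h → to f x , to f x′ , cong just (strictlyInverseʳ f x) , cong just (strictlyInverseʳ f x′) , hom h
  }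

-- Permutation routing

minUpTo : (ℕ → ℕ) → ℕ → ℕ
minUpTo f zero    = f zero
minUpTo f (suc n) = minUpTo f n ⊓ f (suc n)

minUpTo-≤ : ∀ f {n j} → j ≤ n → minUpTo f n ≤ f j
minUpTo-≤ f {zero}  z≤n = ℕ.≤-refl
minUpTo-≤ f {suc n} {j} j≤ with ℕ.m≤n⇒m<n∨m≡n j≤
... | inj₁ (s≤s j≤n) = ℕ.≤-trans (ℕ.m⊓n≤m _ _) (minUpTo-≤ f j≤n)
... | inj₂ refl      = ℕ.m⊓n≤n (minUpTo f n) _

minUpTo-attained : ∀ f n → ∃ λ j → j ≤ n × minUpTo f n ≡ f j
minUpTo-attained f zero = 0 , z≤n , refl
minUpTo-attained f (suc n) with ℕ.⊓-sel (minUpTo f n) (f (suc n))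
... | inj₂ p = suc n , ℕ.≤-refl , p
... | inj₁ p with minUpTo-attained f n
...   | j , j≤n , q = j , ℕ.m≤n⇒m≤1+n j≤n , trans p q

-- σ reverses the orbits of ρ = τ ∘ σ and maps none of them to itself, so x may be coloured by
-- comparing the least elements of the orbits of x and of σ x.
module TwoColouring {X : Set} {N : ℕ} (index : X → Fin N) (index-injective : ∀ {x y} → index x ≡ index y → x ≡ y)
  (σ τ : X → X) (σσ : ∀ x → σ (σ x) ≡ x) (ττ : ∀ x → τ (τ x) ≡ x)
  (σ≢ : ∀ x → σ x ≢ x) (τ≢ : ∀ x → τ x ≢ x) where

  ρ : X → X
  ρ = τ ∘ σ

  ρ^ : ℕ → X → X
  ρ^ zero    x = x
  ρ^ (suc j) x = ρ^ j (ρ x)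

  ρ^-suc : ∀ j x → ρ^ (suc j) x ≡ ρ (ρ^ j x)
  ρ^-suc zero    x = refl
  ρ^-suc (suc j) x = ρ^-suc j (ρ x)

  ρ^-+ : ∀ i j x → ρ^ (i + j) x ≡ ρ^ j (ρ^ i x)
  ρ^-+ zero    j x = refl
  ρ^-+ (suc i) j x = ρ^-+ i j (ρ x)

  ρ-injective : ∀ {x y} → ρ x ≡ ρ y → x ≡ y
  ρ-injective {x} {y} p = trans (sym (σσ x)) (trans (cong σ (trans (sym (ττ (σ x))) (trans (cong τ p) (ττ (σ y))))) (σσ y))

  ρ^-injective : ∀ j {x y} → ρ^ j x ≡ ρ^ j y → x ≡ y
  ρ^-injective zero    p = p
  ρ^-injective (suc j) p = ρ-injective (ρ^-injective j p)

  ρσρ : ∀ x → ρ (σ (ρ x)) ≡ σ x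
  ρσρ x = trans (cong τ (σσ (ρ x))) (ττ (σ x))

  ρ^σρ^ : ∀ j x → ρ^ j (σ (ρ^ j x)) ≡ σ x
  ρ^σρ^ zero    x = refl
  ρ^σρ^ (suc j) x = trans (ρ^-suc j _) (trans (cong ρ (ρ^σρ^ j (ρ x))) (ρσρ x))

  -- Since `ρ ∘ σ ∘ ρ` equals `σ`, the equation for `j + 2` at `x` yields the one for `j` at `ρ x`.
  -- The descent ends in a fixed point of `σ` or of `τ`.
  σ∉orbit : ∀ j x → σ x ≢ ρ^ j x
  σ∉orbit zero          x p = σ≢ x p
  σ∉orbit (suc zero)    x p = τ≢ (σ x) (sym p)
  σ∉orbit (suc (suc j)) x p = σ∉orbit j (ρ x) (ρ-injective (trans (ρσρ x) (trans p (ρ^-suc j (ρ x)))))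

  -- Pigeonhole, after which injectivity of `ρ` cancels the common initial segment. The bound
  -- `p ≤ N` ensures that the iterates inspected by `least` exhaust the orbit.
  period : ∀ x → ∃ λ p → p ≤ N × ρ^ (suc p) x ≡ x
  period x with Fin.pigeonhole (ℕ.n<1+n N) (λ j → index (ρ^ (toℕ j) x))
  ... | i , j , i<j , same = p , ℕ.≤-trans p≤j (ℕ.≤-pred (Fin.toℕ<n j)) , sym (ρ^-injective (toℕ i) eq)
    where
    p = toℕ j ∸ suc (toℕ i)
    p+i≡j : suc p + toℕ i ≡ toℕ j
    p+i≡j = trans (sym (ℕ.+-suc p (toℕ i))) (ℕ.m∸n+n≡m i<j)
    p≤j : p ≤ toℕ j
    p≤j = ℕ.m∸n≤m (toℕ j) (suc (toℕ i))
    eq : ρ^ (toℕ i) x ≡ ρ^ (toℕ i) (ρ^ (suc p) x)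
    eq = trans (index-injective same) (trans (cong (λ l → ρ^ l x) (sym p+i≡j)) (ρ^-+ (suc p) (toℕ i) x))

  least : X → ℕ
  least x = minUpTo (λ j → toℕ (index (ρ^ j x))) N

  least-ρ-≤ : ∀ x → least (ρ x) ≤ least x
  least-ρ-≤ x with minUpTo-attained (λ j → toℕ (index (ρ^ j x))) N
  ... | suc j , j<N , p = ℕ.≤-trans (minUpTo-≤ _ (ℕ.<⇒≤ j<N)) (ℕ.≤-reflexive (sym p))
  ... | zero  , _   , p with period x
  ...   | q , q≤N , r = ℕ.≤-trans (minUpTo-≤ _ q≤N) (ℕ.≤-reflexive (trans (cong (toℕ ∘ index) r) (sym p)))

  least-ρ^-≤ : ∀ j x → least (ρ^ j x) ≤ least x
  least-ρ^-≤ zero    x = ℕ.≤-refl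
  least-ρ^-≤ (suc j) x = ℕ.≤-trans (least-ρ^-≤ j (ρ x)) (least-ρ-≤ x)

  least-ρ : ∀ x → least (ρ x) ≡ least x
  least-ρ x with period x
  ... | q , _ , r = ℕ.≤-antisym (least-ρ-≤ x)
    (ℕ.≤-trans (ℕ.≤-reflexive (cong least (sym r))) (least-ρ^-≤ q (ρ x)))

  -- Because `σ` reverses orbits, a common element `y` of the orbits of `x` and `σ x` would put
  -- `σ (σ y)` on the orbit of `σ y`.
  least-σ : ∀ x → least x ≢ least (σ x)
  least-σ x p with minUpTo-attained (λ j → toℕ (index (ρ^ j x))) N
                 | minUpTo-attained (λ j → toℕ (index (ρ^ j (σ x)))) N
  ... | i , _ , pi | j , _ , pj = σ∉orbit (j + i) (σ y) (sym meet)
    where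
    y = ρ^ i x
    same : y ≡ ρ^ j (σ x)
    same = index-injective (Fin.toℕ-injective (trans (sym pi) (trans p pj)))
    meet : ρ^ (j + i) (σ y) ≡ σ (σ y)
    meet = begin
      ρ^ (j + i) (σ y)               ≡⟨ ρ^-+ j i (σ y) ⟩
      ρ^ i (ρ^ j (σ y))              ≡⟨ cong (λ z → ρ^ i (ρ^ j (σ z))) same ⟩
      ρ^ i (ρ^ j (σ (ρ^ j (σ x))))   ≡⟨ cong (ρ^ i) (trans (ρ^σρ^ j (σ x)) (σσ x)) ⟩
      y                              ≡⟨ σσ y ⟨
      σ (σ y)                        ∎
      where open ≡-Reasoning

  colour : X → Bool
  colour x = ⌊ least x ℕ.<? least (σ x) ⌋

  <?-swap : ∀ {m n} → m ≢ n → ⌊ n ℕ.<? m ⌋ ≡ not ⌊ m ℕ.<? n ⌋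
  <?-swap {m} {n} m≢n with m ℕ.<? n | n ℕ.<? m
  ... | yes m<n | yes n<m = contradiction n<m (ℕ.<-asym m<n)
  ... | yes _   | no  _   = refl
  ... | no  _   | yes _   = refl
  ... | no  m≮n | no  n≮m = contradiction (ℕ.≤-antisym (ℕ.≮⇒≥ n≮m) (ℕ.≮⇒≥ m≮n)) m≢n

  colour-σ : ∀ x → colour (σ x) ≡ not (colour x)
  colour-σ x = trans (cong (λ z → ⌊ least (σ x) ℕ.<? least z ⌋) (σσ x)) (<?-swap (least-σ x))

  -- `τ x` lies on the orbit of `σ x`, and `σ (τ x)` on that of `x`, so `τ` interchanges the two
  -- minima just as `σ` does.
  colour-τ : ∀ x → colour (τ x) ≡ not (colour x)
  colour-τ x = trans (cong₂ (λ a b → ⌊ a ℕ.<? b ⌋) least-τ least-στ) (<?-swap (least-σ x))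
    where
    least-τ : least (τ x) ≡ least (σ x)
    least-τ = trans (cong (least ∘ τ) (sym (σσ x))) (least-ρ (σ x))
    least-στ : least (σ (τ x)) ≡ least x
    least-στ = trans (sym (least-ρ (σ (τ x)))) (cong least (trans (cong τ (σσ (τ x))) (ττ x)))

-- Layers of swaps and the Beneš network

-- A matching in the cube whose edges are swapped simultaneously. `side` tells the two ends of a
-- swap apart, so that their tokens can be sent through different ports.
record Layer (k : ℕ) : Set where
  field
    act        : Word k → Word k
    side       : Word k → Bool
    involutive : ∀ v → act (act v) ≡ v
    moves      : ∀ v → act v ≡ v ⊎ (Adj v (act v) × side (act v) ≡ not (side v))

open Layer using (act; side; involutive; moves)

data Route {k : ℕ} : ℕ → (Word k → Word k) → Set where
  nil  : ∀ {f} → (∀ v → f v ≡ v) → Route 0 f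
  cons : ∀ {L f h} (g : Layer k) → Route L f → (∀ v → h v ≡ f (act g v)) → Route (suc L) h

idLayer : ∀ {k} → Layer k
idLayer = record { act = id ; side = λ _ → false ; involutive = λ _ → refl ; moves = λ _ → inj₁ refl }

route-pad : ∀ {k L} M {f : Word k → Word k} → Route L f → Route (M + L) f
route-pad zero    r = r
route-pad (suc M) r = cons idLayer (route-pad M r) (λ _ → refl)

route-snoc : ∀ {k L} {f : Word k → Word k} → Route L f → (g : Layer k) → Route (suc L) (act g ∘ f)
route-snoc (nil p)      g = cons g (nil (λ _ → refl)) (λ v → cong (act g) (p v))
route-snoc (cons h r p) g = cons h (route-snoc r g) (λ v → cong (act g) (p v))

halves : ∀ {k} → (Bool → Word k → Word k) → Word (suc k) → Word (suc k)
halves f (b ∷ w) = b ∷ f b w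

halvesLayer : ∀ {k} → (Bool → Layer k) → Layer (suc k)
halvesLayer g = record
  { act        = halves (λ b → act (g b))
  ; side       = λ { (b ∷ w) → side (g b) w }
  ; involutive = λ { (b ∷ w) → cong (b ∷_) (involutive (g b) w) }
  ; moves      = λ { (b ∷ w) → moves′ b w (moves (g b) w) }
  }
  where
  moves′ : ∀ b w → act (g b) w ≡ w ⊎ (Adj w (act (g b) w) × side (g b) (act (g b) w) ≡ not (side (g b) w)) → _
  moves′ b w (inj₁ p)       = inj₁ (cong (b ∷_) p)
  moves′ b w (inj₂ (a , p)) = inj₂ (keep a , p)

-- The two subcubes are routed in parallel, which keeps the depth of the network linear in `k`.
route-halves : ∀ {k L} {f : Bool → Word k → Word k} → (∀ b → Route L (f b)) → Route L (halves f)
route-halves {L = zero} {f} r = nil (λ { (b ∷ w) → cong (b ∷_) (fixed b w (r b)) })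
  where
  fixed : ∀ b w → Route 0 (f b) → f b w ≡ w
  fixed b w (nil p) = p w
route-halves {k} {suc L} {f} r = cons (halvesLayer (λ b → layer (r b))) (route-halves (λ b → rest (r b)))
                                (λ { (b ∷ w) → cong (b ∷_) (split (r b) w) })
  where
  layer : ∀ {h : Word k → Word k} → Route (suc L) h → Layer k
  layer (cons g _ _) = g
  remaining : ∀ {h : Word k → Word k} → Route (suc L) h → Word k → Word k
  remaining (cons {f = f} _ _ _) = f
  rest : ∀ {h : Word k → Word k} (r : Route (suc L) h) → Route L (remaining r)
  rest (cons _ r _) = r
  split : ∀ {h : Word k → Word k} (r : Route (suc L) h) → ∀ w → h w ≡ remaining r (act (layer r) w)
  split (cons _ _ p) = p

flipHead : ∀ {k} → Word (suc k) → Word (suc k)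
flipHead (b ∷ w) = not b ∷ w

module Switch {k : ℕ} (c : Word (suc k) → Bool) (c-flip : ∀ x → c (flipHead x) ≡ not (c x)) where

  -- Moves `x` within the pair of `x` and `flipHead x` to the half named by its colour. The colour
  -- is read at the member with leading bit `false`, so that both members take the same decision.
  choose : Word (suc k) → Word (suc k)
  choose (b ∷ w) = (c (false ∷ w) xor b) ∷ w

  c-head : ∀ b w → c (b ∷ w) ≡ c (false ∷ w) xor b
  c-head false w = sym (trans (Bool.xor-comm (c (false ∷ w)) false) refl)
  c-head true  w = trans (c-flip (false ∷ w)) (sym (Bool.xor-comm (c (false ∷ w)) true))

  choose-involutive : ∀ x → choose (choose x) ≡ x
  choose-involutive (b ∷ w) = cong (_∷ w) (trans (sym (Bool.xor-assoc (c (false ∷ w)) _ b)) (cong (_xor b) (Bool.xor-same (c (false ∷ w)))))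

  choose-colour : ∀ x → choose x ≡ c x ∷ Vec.tail x
  choose-colour (b ∷ w) = cong (_∷ w) (sym (c-head b w))

  colour-choose : ∀ b w → c (choose (b ∷ w)) ≡ b
  colour-choose b w = cong Vec.head (trans (sym (choose-colour (choose (b ∷ w)))) (choose-involutive (b ∷ w)))

  choose-unique : ∀ x → choose (c x ∷ Vec.tail x) ≡ x
  choose-unique x = trans (cong choose (sym (choose-colour x))) (choose-involutive x)

  layer : Layer (suc k)
  layer = record
    { act        = choose
    ; side       = Vec.head
    ; involutive = choose-involutive
    ; moves      = moves′
    }
    where
    moves′ : ∀ x → choose x ≡ x ⊎ (Adj x (choose x) × Vec.head (choose x) ≡ not (Vec.head x))
    moves′ (b ∷ w) with c (false ∷ w)
    ... | false = inj₁ refl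
    ... | true  = inj₂ (flip , refl)

-- The pairs of `σ` (partners at the input) and of `τ` (partners at the output) are two perfect
-- matchings, and `colour` properly colours their union. Hence each half can receive one token of
-- every input pair and one of every output pair: an input switch, a permutation of each half and an
-- output switch realise `π`, at two layers per dimension.
benes : ∀ k (π : Word k ↔ Word k) → Route (k * 2) (to π)
benes zero    π = nil (λ { [] → empty (to π []) })
  where
  empty : (w : Word 0) → w ≡ []
  empty [] = refl
benes (suc k) π =
  cons In.layer (route-snoc (route-halves (λ s → benes k (middle s))) Out.layer) factor
  where
  σ = flipHead
  σσ : ∀ (x : Word (suc k)) → σ (σ x) ≡ x
  σσ (b ∷ w) = cong (_∷ w) (Bool.not-involutive b)
  σ≢ : ∀ (x : Word (suc k)) → σ x ≢ x
  σ≢ (true  ∷ w) ()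
  σ≢ (false ∷ w) ()
  τ = λ x → from π (σ (to π x))
  ττ : ∀ x → τ (τ x) ≡ x
  ττ x = trans (cong (from π) (trans (cong σ (strictlyInverseˡ π _)) (σσ _))) (strictlyInverseʳ π x)
  τ≢ : ∀ x → τ x ≢ x
  τ≢ x p = σ≢ (to π x) (trans (sym (strictlyInverseˡ π _)) (cong (to π) p))
  unbits-injective : ∀ {x y : Word (suc k)} → unbits (suc k) x ≡ unbits (suc k) y → x ≡ y
  unbits-injective {x} {y} p = trans (sym (bits-unbits (suc k) x)) (trans (cong (bits (suc k)) p) (bits-unbits (suc k) y))

  open TwoColouring (unbits (suc k)) unbits-injective σ τ σσ ττ σ≢ τ≢

  module In = Switch colour colour-σ

  colour-from-σ : ∀ y → colour (from π (σ y)) ≡ not (colour (from π y))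
  colour-from-σ y = trans (cong (colour ∘ from π ∘ σ) (sym (strictlyInverseˡ π y))) (colour-τ (from π y))

  module Out = Switch (colour ∘ from π) colour-from-σ

  -- `In.choose (s ∷ w)` is the token that the input switch brings to `s ∷ w`. Its colour is `s`, so
  -- the output switch expects it in the half `s`.
  out : ∀ s w → Out.choose (s ∷ Vec.tail (to π (In.choose (s ∷ w)))) ≡ to π (In.choose (s ∷ w))
  out s w = trans (cong (λ z → Out.choose (z ∷ Vec.tail (to π x))) (sym (trans (cong colour (strictlyInverseʳ π x)) (In.colour-choose s w))))
                  (Out.choose-unique (to π x))
    where x = In.choose (s ∷ w)

  inn : ∀ s w → In.choose (s ∷ Vec.tail (from π (Out.choose (s ∷ w)))) ≡ from π (Out.choose (s ∷ w))
  inn s w = trans (cong (λ z → In.choose (z ∷ Vec.tail (from π y))) (sym (Out.colour-choose s w)))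
                  (In.choose-unique (from π y))
    where y = Out.choose (s ∷ w)

  middle : Bool → Word k ↔ Word k
  middle s = mk↔ₛ′
    (λ w → Vec.tail (to π (In.choose (s ∷ w))))
    (λ w → Vec.tail (from π (Out.choose (s ∷ w))))
    (λ w → cong Vec.tail (trans (cong (to π) (inn s w)) (strictlyInverseˡ π _)))
    (λ w → cong Vec.tail (trans (cong (from π) (out s w)) (strictlyInverseʳ π _)))

  factor : ∀ v → to π v ≡ Out.choose (halves (λ s → to (middle s)) (In.choose v))
  factor v = sym (begin
    Out.choose (halves (λ s → to (middle s)) (In.choose v))
      ≡⟨ cong (Out.choose ∘ halves (λ s → to (middle s))) (In.choose-colour v) ⟩
    Out.choose (colour v ∷ Vec.tail (to π (In.choose (colour v ∷ Vec.tail v))))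
      ≡⟨ out (colour v) (Vec.tail v) ⟩
    to π (In.choose (colour v ∷ Vec.tail v))
      ≡⟨ cong (to π) (In.choose-unique v) ⟩
    to π v ∎)
    where open ≡-Reasoning

-- The layered host graph

data Port : Set where
  inn : Port
  mid : Bool → Port
  out : Port

Host : ℕ → ℕ → Set
Host k T = Word k × Port × Fin T

-- At a fixed word and time the ports form a 4-cycle. There are two middle rows because the tokens
-- of a swap traverse the same cube edge in opposite directions and need disjoint copies of it.
data HostAdj {k T : ℕ} : Host k T → Host k T → Set where
  row   : ∀ {v w p t} → Adj v w → HostAdj (v , p , t) (w , p , t)
  enter : ∀ {w s t} → HostAdj (w , inn , t) (w , mid s , t)
  exit  : ∀ {w s t} → HostAdj (w , mid s , t) (w , out , t)
  link  : ∀ {w t t′} → toℕ t′ ≡ suc (toℕ t) → HostAdj (w , out , t) (w , inn , t′)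
  back  : ∀ {x y} → HostAdj x y → HostAdj y x

later : ∀ {k T} → Host k T → Host k (suc T)
later (w , p , t) = w , p , suc t

later-adj : ∀ {k T} {x y : Host k T} → HostAdj x y → HostAdj (later x) (later y)
later-adj (row a)  = row a
later-adj enter    = enter
later-adj exit     = exit
later-adj (link p) = link (cong suc p)
later-adj (back a) = back (later-adj a)

-- Roots at the in-ports of time 0 give every branch set an entrance to which a further layer can be
-- attached in front.
record Rooted {k : ℕ} (F : Word k → Word k → Set) (L : ℕ) : Set where
  field
    model  : Model F (HostAdj {k} {suc L})
  open Model model public
  field
    root≡  : ∀ v → root v ≡ (v , inn , 0F)

rooted-cube : ∀ {k} → Rooted (Adj {k}) 0
rooted-cube {k} = record
  { model = record
    { φ      = just ∘ proj₁
    ; root   = λ v → v , inn , 0F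
    ; φ-root = λ _ → refl
    ; conn   = conn
    ; edge   = λ {u} {v} a → (u , inn , 0F) , (v , inn , 0F) , refl , refl , row a
    }
  ; root≡ = λ _ → refl
  }
  where
  conn : ∀ {x v} → just (proj₁ x) ≡ just v → Star (Within (HostAdj {k} {1}) (just ∘ proj₁) v) (v , inn , 0F) x
  conn {_ , inn   , 0F} refl = ε
  conn {_ , mid s , 0F} refl = (enter , refl , refl) ◅ ε
  conn {_ , out   , 0F} refl = (enter , refl , refl) ◅ (exit {s = false} , refl , refl) ◅ ε

module AddLayer {k L : ℕ} {F F′ : Word k → Word k → Set} (g : Layer k)
                (F′⇒F : ∀ {u v} → F′ u v → F (act g u) (act g v)) (R : Rooted F L) where

  open Rooted R

  -- When act g swaps w and act g w, the mid-ports with label s of both carry the token that starts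
  -- on side s, so the two crossing tokens use disjoint ports.
  pick : Bool → Word k → Word k
  pick s w = if side g w xor s then act g w else w

  token : Port → Word k → Word k
  token inn     w = w
  token (mid s) w = pick s w
  token out     w = act g w

  -- The new layer occupies time 0 and the old model is delayed by one step. The old label `v′`
  -- becomes `act g v′`, the word whose token the layer brings to `v′`.
  φ′ : Host k (suc (suc L)) → Maybe (Word k)
  φ′ (w , p , 0F)    = just (token p w)
  φ′ (w , p , suc t) = Maybe.map (act g) (φ (w , p , t))

  φ′-later : ∀ {x v} → φ x ≡ just (act g v) → φ′ (later x) ≡ just v
  φ′-later {x} {v} p = trans (cong (Maybe.map (act g)) p) (cong just (involutive g v))

  within-later : ∀ {x y v} → Within HostAdj φ (act g v) x y → Within HostAdj φ′ v (later x) (later y)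
  within-later (a , p , q) = later-adj a , φ′-later p , φ′-later q

  pick-own : ∀ v → pick (side g v) v ≡ v
  pick-own v = cong (if_then act g v else v) (Bool.xor-same (side g v))

  pick-partner : ∀ {s} v → side g (act g v) ≡ not s → pick s (act g v) ≡ v
  pick-partner {s} v p = trans (cong (λ b → if b xor s then act g (act g v) else act g v) p)
    (trans (cong (if_then act g (act g v) else act g v) (not-xor s)) (involutive g v))
    where
    not-xor : ∀ s → not s xor s ≡ true
    not-xor true  = refl
    not-xor false = refl

  start : Word k → Host k (suc (suc L))
  start v = v , inn , 0F

  Path : Word k → Host k (suc (suc L)) → Host k (suc (suc L)) → Set
  Path v = Star (Within HostAdj φ′ v)

  toMid : ∀ v → Path v (start v) (v , mid (side g v) , 0F)
  toMid v = (enter , refl , cong just (pick-own v)) ◅ ε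

  toPartner : ∀ {s} v → side g v ≡ s → side g (act g v) ≡ not s → Adj v (act g v) →
              Path v (start v) (act g v , mid s , 0F)
  toPartner v refl p a = toMid v ◅◅ (row a , cong just (pick-own v) , cong just (pick-partner v p)) ◅ ε

  toOut : ∀ v → Path v (start v) (act g v , out , 0F)
  toOut v with moves g v
  ... | inj₁ p       = subst (λ w → Path v (start v) (w , out , 0F)) (sym p)
                         (toMid v ◅◅ (exit , cong just (pick-own v) , cong just p) ◅ ε)
  ... | inj₂ (a , p) = toPartner v refl p a ◅◅
                         (exit , cong just (pick-partner v p) , cong just (involutive g v)) ◅ ε

  toLater : ∀ v → Path v (start v) (later (act g v , inn , 0F))
  toLater v = toOut v ◅◅ (link refl , cong just (involutive g v)
    , φ′-later (trans (cong φ (sym (root≡ (act g v)))) (φ-root (act g v)))) ◅ ε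

  -- A port labelled by its own word is entered directly, which includes the second middle port of a
  -- word fixed by the layer. Any other port lies on the path of the partner's token.
  toAnyMid : ∀ s w {v} → pick s w ≡ v → Path v (start v) (w , mid s , 0F)
  toAnyMid s w {v} p with side g w xor s in eq
  toAnyMid s w {v} refl | false = (enter , refl , cong (λ b → just (if b then act g w else w)) eq) ◅ ε
  toAnyMid s w {v} refl | true with moves g w
  ... | inj₁ fixed = subst (λ z → Path (act g w) (start z) (w , mid s , 0F)) (sym fixed)
          ((enter , cong just (sym fixed) , cong (λ b → just (if b then act g w else w)) eq) ◅ ε)
  ... | inj₂ (a , q) = subst (λ z → Path (act g w) (start (act g w)) (z , mid s , 0F)) (involutive g w)
          (toPartner (act g w) (trans q (swapped (side g w) s eq))
            (trans (cong (side g) (involutive g w)) (swapped′ (side g w) s eq))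
            (subst (Adj (act g w)) (sym (involutive g w)) (adj-sym a)))
    where
    swapped : ∀ b s → b xor s ≡ true → not b ≡ s
    swapped true  false _ = refl
    swapped false true  _ = refl
    swapped′ : ∀ b s → b xor s ≡ true → b ≡ not s
    swapped′ true  false _ = refl
    swapped′ false true  _ = refl

  conn′ : ∀ {x v} → φ′ x ≡ just v → Path v (start v) x
  conn′ {w , inn   , 0F} refl = ε
  conn′ {w , mid s , 0F} p    = toAnyMid s w (just-injective p)
  conn′ {w , out   , 0F} {v} refl =
    subst (λ z → Path v (start v) (z , out , 0F)) (involutive g w) (toOut v)
  conn′ {w , p , suc t} {v} q with φ (w , p , t) in eq
  conn′ {w , p , suc t} refl | just v′ =
    toLater (act g v′) ◅◅
    subst (λ z → Path (act g v′) (later (z , inn , 0F)) (w , p , suc t)) (sym (involutive g v′))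
      (Star.gmap later within-later
        (subst (λ z → Star (Within HostAdj φ (act g (act g v′))) z (w , p , t)) (root≡ v′)
          (subst (λ z → Star (Within HostAdj φ z) (root v′) (w , p , t)) (sym (involutive g v′)) (conn eq))))

  rooted : Rooted F′ (suc L)
  rooted = record
    { model = record
      { φ      = φ′
      ; root   = start
      ; φ-root = λ _ → refl
      ; conn   = conn′
      ; edge   = edge′
      }
    ; root≡ = λ _ → refl
    }
    where
    edge′ : ∀ {u v} → F′ u v → ∃₂ λ x y → φ′ x ≡ just u × φ′ y ≡ just v × HostAdj x y
    edge′ h with edge (F′⇒F h)
    ... | x , y , p , q , a = later x , later y , φ′-later p , φ′-later q , later-adj a

-- The last time step holds a plain copy of the cube. Layers are attached in front of it one by one,
-- so that its edges, seen from time 0, join tokens with adjacent destinations.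
route-rooted : ∀ {k L} {f : Word k → Word k} → Route L f → Rooted (λ u v → Adj (f u) (f v)) L
route-rooted (nil p) = record
  { model = record
    { φ = φ ; root = root ; φ-root = φ-root ; conn = conn
    ; edge = λ {u} {v} a → edge (subst (Adj u) (p v) (subst (λ z → Adj z _) (p u) a)) }
  ; root≡ = root≡ }
  where open Rooted rooted-cube
route-rooted (cons g r p) = AddLayer.rooted g
  (λ {u} {v} a → subst (Adj _) (p v) (subst (λ z → Adj z _) (p u) a)) (route-rooted r)

TwoCubes : ∀ {k} → Word k ↔ Word k → Word k → Word k → Set
TwoCubes π u v = Adj u v ⊎ Adj (to π u) (to π v)

-- Edges of the first cube are found among the in-ports at time 0, those of the second one after all
-- layers. Padding by identity layers brings the number of time steps to exactly `T`.
twoCubes-host : ∀ {k} (π : Word k ↔ Word k) {T} → k * 2 < T → Model (TwoCubes π) (HostAdj {k} {T})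
twoCubes-host {k} π {suc L} (s≤s k2≤L) = record
  { φ = φ ; root = root ; φ-root = φ-root ; conn = conn ; edge = edge′ }
  where
  open Rooted (route-rooted (subst (λ L → Route L (to π)) (ℕ.m∸n+n≡m k2≤L) (route-pad (L ∸ k * 2) (benes k π))))
  edge′ : ∀ {u v} → TwoCubes π u v → ∃₂ λ x y → φ x ≡ just u × φ y ≡ just v × HostAdj x y
  edge′ (inj₂ a) = edge a
  edge′ {u} {v} (inj₁ a) = root u , root v , φ-root u , φ-root v ,
    subst (HostAdj (root u)) (sym (root≡ v)) (subst (λ z → HostAdj z (v , inn , 0F)) (sym (root≡ u)) (row a))

-- Embedding of the host graph in a hypercube

parity : ℕ → Bool
parity zero    = false
parity (suc n) = not (parity n)

-- The ports form a 4-cycle; reflecting it at every other time makes the out-port at time t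
-- coincide with the in-port at time t + 1.
encode : Bool → Port → Bool × Bool
encode c inn         = c , c
encode c (mid false) = c , not c
encode c (mid true)  = not c , c
encode c out         = not c , not c

decode : Bool → Bool × Bool → Port
decode c (a , b) = port (c xor a) (c xor b)
  where
  port : Bool → Bool → Port
  port false false = inn
  port false true  = mid false
  port true  false = mid true
  port true  true  = out

decode-encode : ∀ c p → decode c (encode c p) ≡ p
decode-encode true  inn         = refl
decode-encode true  (mid false) = refl
decode-encode true  (mid true)  = refl
decode-encode true  out         = refl
decode-encode false inn         = refl
decode-encode false (mid false) = refl
decode-encode false (mid true)  = refl
decode-encode false out         = refl

encode-decode : ∀ c p → encode c (decode c p) ≡ p
encode-decode true  (true  , true)  = refl
encode-decode true  (true  , false) = refl
encode-decode true  (false , true)  = refl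
encode-decode true  (false , false) = refl
encode-decode false (true  , true)  = refl
encode-decode false (true  , false) = refl
encode-decode false (false , true)  = refl
encode-decode false (false , false) = refl

module _ {k l : ℕ} where

  place : Bool × Bool → Word (l + k) → Word (2 + (l + k))
  place (a , b) w = a ∷ b ∷ w

  toCube : Host k (2 ^ l) → Word (2 + (l + k))
  toCube (w , p , t) = place (encode (parity (toℕ t)) p) (to (gray l) t Vec.++ w)

  fromCube : Word (2 + (l + k)) → Host k (2 ^ l)
  fromCube (a ∷ b ∷ v) = Vec.drop l v , decode (parity (toℕ t)) (a , b) , t
    where t = from (gray l) (Vec.take l v)

  take-++ : ∀ {l} (u : Word l) (w : Word k) → Vec.take l (u Vec.++ w) ≡ u
  take-++ []      w = refl
  take-++ (x ∷ u) w = cong (x ∷_) (take-++ u w)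

  drop-++ : ∀ {l} (u : Word l) (w : Word k) → Vec.drop l (u Vec.++ w) ≡ w
  drop-++ []      w = refl
  drop-++ (x ∷ u) w = drop-++ u w

  fromCube-toCube : ∀ x → fromCube (toCube x) ≡ x
  fromCube-toCube (w , p , t)
    rewrite take-++ (to (gray l) t) w | drop-++ (to (gray l) t) w | strictlyInverseʳ (gray l) t
          | decode-encode (parity (toℕ t)) p = refl

  toCube-fromCube : ∀ v → toCube (fromCube v) ≡ v
  toCube-fromCube (a ∷ b ∷ v) = cong₂ place
    (encode-decode (parity (toℕ (from (gray l) (Vec.take l v)))) (a , b))
    (trans (cong (Vec._++ Vec.drop l v) (strictlyInverseˡ (gray l) (Vec.take l v))) (Vec.take++drop≡id l v))

  enter-adj : ∀ c s w → Adj (place (encode c inn) w) (place (encode c (mid s)) w)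
  enter-adj c true  w = flip
  enter-adj c false w = keep flip

  exit-adj : ∀ c s w → Adj (place (encode c (mid s)) w) (place (encode c out) w)
  exit-adj c true  w = keep flip
  exit-adj c false w = flip

  toCube-adj : ∀ {x y} → HostAdj x y → Adj (toCube x) (toCube y)
  toCube-adj (row {t = t} a)     = keep (keep (adj-++ʳ (to (gray l) t) a))
  toCube-adj (enter {w} {s} {t}) = enter-adj (parity (toℕ t)) s _
  toCube-adj (exit {w} {s} {t})  = exit-adj (parity (toℕ t)) s _
  -- The parity changes from `t` to `t′`, so the port bits agree and only the Gray code of the time
  -- moves.
  toCube-adj (link {w} {t} {t′} p) rewrite p =
    keep (keep (adj-++ˡ w (gray-consecutive l (inj₁ p))))
  toCube-adj (back a) = adj-sym (toCube-adj a)

  host-cube : Model (HostAdj {k} {2 ^ l}) (Adj {2 + (l + k)})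
  host-cube = spanning-model (mk↔ₛ′ toCube fromCube toCube-fromCube fromCube-toCube) toCube-adj

twoCubes-cube : ∀ {k l} (π : Word k ↔ Word k) → k * 2 < 2 ^ l → Model (TwoCubes π) (Adj {2 + (l + k)})
twoCubes-cube π k2<2^l = model-trans adj-sym (twoCubes-host π k2<2^l) host-cube

-- Universality

isEdge : {n : ℕ} → Graph n → Fin n × Fin n → Bool
isEdge G (i , j) = G i j ∧ ⌊ i Fin.<? j ⌋

edges : {n : ℕ} → Graph n → List (Fin n × Fin n)
edges {n} G = filter (λ e → isEdge G e Bool.≟ true) (cartesianProduct (allFin n) (allFin n))

length-edges : {n : ℕ} (G : Graph n) → length (edges G) ≡ edgeCount G
length-edges {n} G = rows (allFin n)
  where
  P? = λ e → isEdge G e Bool.≟ true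
  row-length : ∀ i js → length (filter P? (map (i ,_) js)) ≡
               sum (map (λ j → if G i j ∧ ⌊ i Fin.<? j ⌋ then 1 else 0) js)
  row-length i []       = refl
  row-length i (j ∷ js) with isEdge G (i , j)
  ... | true  = cong suc (row-length i js)
  ... | false = row-length i js
  rows : ∀ is → length (filter P? (cartesianProduct is (allFin n))) ≡
         sum (map (λ i → sum (map (λ j → if G i j ∧ ⌊ i Fin.<? j ⌋ then 1 else 0) (allFin n))) is)
  rows []       = refl
  rows (i ∷ is) = trans (cong length (List.filter-++ P? (map (i ,_) (allFin n)) _))
    (trans (List.length-++ (filter P? (map (i ,_) (allFin n)))) (cong₂ _+_ (row-length i (allFin n)) (rows is)))

isEdge⁺ : {n : ℕ} (G : Graph n) {i j : Fin n} → Edge G i j → i Fin.< j → isEdge G (i , j) ≡ true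
isEdge⁺ G {i} {j} g i<j rewrite g with i Fin.<? j
... | yes _  = refl
... | no i≮j = contradiction i<j i≮j

∈-edges : {n : ℕ} {G : Graph n} → IsSimple G → ∀ {i j} → Edge G i j → (i , j) ∈ edges G ⊎ (j , i) ∈ edges G
∈-edges {n} {G} s {i} {j} g with Fin.<-cmp i j
... | tri< i<j _ _  = inj₁ (∈-filter⁺ _ (∈-cartesianProduct⁺ (∈-allFin i) (∈-allFin j)) (isEdge⁺ G g i<j))
... | tri≈ _ refl _ = contradiction (trans (sym g) (IsSimple.irrefl s i)) λ ()
... | tri> _ _ j<i  = inj₂ (∈-filter⁺ _ (∈-cartesianProduct⁺ (∈-allFin j) (∈-allFin i))
                        (isEdge⁺ G (edge-sym {G = G} s g) j<i))

∈-edges⁻ : {n : ℕ} {G : Graph n} → ∀ {i j} → (i , j) ∈ edges G → Edge G i j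
∈-edges⁻ {n} {G} {i} {j} p with G i j | proj₂ (∈-filter⁻ (λ e → isEdge G e Bool.≟ true) {xs = cartesianProduct (allFin n) (allFin n)} p)
... | true | _ = refl

ends : {A : Set} → List (A × A) → List A
ends []             = []
ends ((i , j) ∷ es) = i ∷ j ∷ ends es

length-ends : {A : Set} (es : List (A × A)) → length (ends es) ≡ length es * 2
length-ends []       = refl
length-ends (e ∷ es) = cong (2 +_) (length-ends es)

ends-consecutive : {A : Set} {i j : A} {es : List (A × A)} (ps : List A) → (i , j) ∈ es →
  ∃₂ λ p q → Consecutive p q × lookup (ends es ++ ps) p ≡ i × lookup (ends es ++ ps) q ≡ j
ends-consecutive ps (here refl) = 0F , 1F , inj₁ refl , refl , refl
ends-consecutive ps (there m) with ends-consecutive ps m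
... | p , q , c , pi , qj = suc (suc p) , suc (suc q) , shift c , pi , qj
  where
  shift : Consecutive p q → Consecutive (suc (suc p)) (suc (suc q))
  shift (inj₁ e) = inj₁ (cong (2 +_) e)
  shift (inj₂ e) = inj₂ (cong (2 +_) e)

-- Fibres of a monotone map are intervals: the successor of `p` is squeezed between `p` and `q`, so
-- it too has label `v`.
monotone-fibre : ∀ {N n} (s : Fin N → Fin n) → (∀ {i j} → i Fin.≤ j → s i Fin.≤ s j) →
                 ∀ {v} δ p q → toℕ q ≡ δ + toℕ p → s p ≡ v → s q ≡ v →
                 Star (Within Consecutive (just ∘ s) v) p q
monotone-fibre s mono zero p q e pv qv rewrite Fin.toℕ-injective e = ε
monotone-fibre {N} s mono {v} (suc δ) p q e pv qv =
  (inj₁ (Fin.toℕ-fromℕ< r<N) , cong just pv , cong just rv) ◅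
  monotone-fibre s mono δ r q r-q rv qv
  where
  q≡ : toℕ q ≡ δ + suc (toℕ p)
  q≡ = trans e (sym (ℕ.+-suc δ (toℕ p)))
  p<q : toℕ p < toℕ q
  p<q = ℕ.≤-trans (ℕ.m≤n+m (suc (toℕ p)) δ) (ℕ.≤-reflexive (sym q≡))
  r<N : suc (toℕ p) < N
  r<N = ℕ.<-≤-trans (s≤s p<q) (Fin.toℕ<n q)
  r = fromℕ< r<N
  r-q : toℕ q ≡ δ + toℕ r
  r-q = trans q≡ (cong (δ +_) (sym (Fin.toℕ-fromℕ< r<N)))
  rv : s r ≡ v
  rv = Fin.≤-antisym
    (subst (s r Fin.≤_) qv (mono (ℕ.≤-trans (ℕ.≤-reflexive (Fin.toℕ-fromℕ< r<N)) p<q)))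
    (subst (Fin._≤ s r) pv (mono (ℕ.≤-trans (ℕ.n≤1+n _) (ℕ.≤-reflexive (sym (Fin.toℕ-fromℕ< r<N))))))

consecutive-sym : ∀ {N} → Symmetric (Consecutive {N})
consecutive-sym (inj₁ p) = inj₂ p
consecutive-sym (inj₂ p) = inj₁ p

grayTo : ∀ {k N} → N ≡ 2 ^ k → Fin N ↔ Word k
grayTo {k} e = gray k ↔-∘ cast-id e

grayTo-adj : ∀ {k N} (e : N ≡ 2 ^ k) {i j} → Consecutive i j → Adj (to (grayTo {k} e) i) (to (grayTo {k} e) j)
grayTo-adj {k} refl {i} {j} c =
  gray-consecutive k (subst₂ Consecutive (sym (Fin.cast-is-id refl i)) (sym (Fin.cast-is-id refl j)) c)

cube-Q : ∀ d → Model (Adj {d}) (Edge (Q d))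
cube-Q d = spanning-model (words d) λ {x} {y} a →
  adj⇒Q-edge d {unbits d x} {unbits d y} (subst₂ Adj (sym (bits-unbits d x)) (sym (bits-unbits d y)) a)

module _ {n : ℕ} {H : Graph n} (sH : IsSimple H) (noIso : NoIsolated H) where

  open Sort (Fin.≤-decTotalOrder n) using (sort; sort-↭; sort-↗)

  -- A word is labelled by the entry at its Gray position in the sorted list, so the first cube
  -- connects the branch sets. `π` sends an occurrence to its place in the unsorted list, where the
  -- ends of an edge stand side by side, so the second cube supplies the edges.
  graph-twoCubes : ∀ k (v₀ : Fin n) → length (edges H) * 2 ≤ 2 ^ k →
                   Σ (Word k ↔ Word k) λ π → Model (Edge H) (TwoCubes π)
  graph-twoCubes k v₀ fits = π , record
    { φ      = φ
    ; root   = λ v → to e₁ (pos v)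
    ; φ-root = λ v → cong just (trans (cong s (strictlyInverseʳ e₁ (pos v))) (pos-label v))
    ; conn   = conn
    ; edge   = edge
    }
    where
    -- Copies of an existing vertex only lengthen its interval, and they make the list as long as
    -- the cube is large.
    padding = replicate (2 ^ k ∸ length (edges H) * 2) v₀
    plain = ends (edges H) ++ padding
    sorted = sort plain

    plain-length : length plain ≡ 2 ^ k
    plain-length = begin
      length plain                               ≡⟨ List.length-++ (ends (edges H)) ⟩
      length (ends (edges H)) + length padding   ≡⟨ cong₂ _+_ (length-ends (edges H)) (List.length-replicate _) ⟩
      length (edges H) * 2 + (2 ^ k ∸ length (edges H) * 2) ≡⟨ ℕ.m+[n∸m]≡n fits ⟩
      2 ^ k                                      ∎
      where open ≡-Reasoning

    e₁ : Fin (length sorted) ↔ Word k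
    e₁ = grayTo (trans (↭-length (sort-↭ plain)) plain-length)
    e₂ : Fin (length plain) ↔ Word k
    e₂ = grayTo plain-length

    e₁-adj : ∀ {i j} → Consecutive i j → Adj (to e₁ i) (to e₁ j)
    e₁-adj = grayTo-adj (trans (↭-length (sort-↭ plain)) plain-length)
    e₂-adj : ∀ {i j} → Consecutive i j → Adj (to e₂ i) (to e₂ j)
    e₂-adj = grayTo-adj plain-length

    permuted = ↭⇒↭ₛ (sort-↭ plain)

    rearrange : Fin (length sorted) ↔ Fin (length plain)
    rearrange = PermutationHomogeneous.onIndices permuted

    s : Fin (length sorted) → Fin n
    s = lookup sorted

    s-rearrange : ∀ i → s i ≡ lookup plain (to rearrange i)
    s-rearrange = PermutationSetoidProperties.onIndices-lookup (setoid (Fin n)) permuted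

    s-from : ∀ i → s (from rearrange i) ≡ lookup plain i
    s-from i = trans (s-rearrange _) (cong (lookup plain) (strictlyInverseˡ rearrange i))

    s-mono : ∀ {i j} → i Fin.≤ j → s i Fin.≤ s j
    s-mono = lookup-mono-≤ (DecTotalOrder.totalOrder (Fin.≤-decTotalOrder n)) (sort-↗ plain)

    π : Word k ↔ Word k
    π = e₂ ↔-∘ (rearrange ↔-∘ ↔-sym e₁)

    φ : Word k → Maybe (Fin n)
    φ w = just (s (from e₁ w))

    locate : ∀ {i j} → Edge H i j → ∃₂ λ p q → Consecutive p q × lookup plain p ≡ i × lookup plain q ≡ j
    locate h with ∈-edges sH h
    ... | inj₁ m = ends-consecutive padding m
    ... | inj₂ m with ends-consecutive padding m
    ...   | p , q , c , pj , qi = q , p , consecutive-sym c , qi , pj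

    -- Here isolated vertices are excluded: a vertex is sure to occur in the list only as an end of
    -- an edge.
    position : ∀ v → ∃ λ p → lookup plain p ≡ v
    position v with locate (proj₂ (noIso v))
    ... | p , _ , _ , pv , _ = p , pv

    pos : Fin n → Fin (length sorted)
    pos v = from rearrange (proj₁ (position v))

    pos-label : ∀ v → s (pos v) ≡ v
    pos-label v = trans (s-from _) (proj₂ (position v))

    fibre : ∀ {v} p q → s p ≡ v → s q ≡ v → Star (Within Consecutive (just ∘ s) v) p q
    fibre p q pv qv with ℕ.≤-total (toℕ p) (toℕ q)
    ... | inj₁ p≤q = monotone-fibre s s-mono (toℕ q ∸ toℕ p) p q (sym (ℕ.m∸n+n≡m p≤q)) pv qv
    ... | inj₂ q≤p = reverse (within-sym {φ = just ∘ s} consecutive-sym)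
                       (monotone-fibre s s-mono (toℕ p ∸ toℕ q) q p (sym (ℕ.m∸n+n≡m q≤p)) qv pv)

    transport : ∀ {v p q} → Within Consecutive (just ∘ s) v p q → Within (TwoCubes π) φ v (to e₁ p) (to e₁ q)
    transport {v} {p} {q} (c , pv , qv) = inj₁ (e₁-adj c)
      , trans (cong (just ∘ s) (strictlyInverseʳ e₁ p)) pv
      , trans (cong (just ∘ s) (strictlyInverseʳ e₁ q)) qv

    conn : ∀ {w v} → φ w ≡ just v → Star (Within (TwoCubes π) φ v) (to e₁ (pos v)) w
    conn {w} {v} p = subst (Star _ _) (strictlyInverseˡ e₁ w)
      (Star.gmap (to e₁) transport (fibre (pos v) (from e₁ w) (pos-label v) (just-injective p)))

    edge : ∀ {u v} → Edge H u v → ∃₂ λ x y → φ x ≡ just u × φ y ≡ just v × TwoCubes π x y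
    edge h = joined (locate h)
      where
      at : Fin (length plain) → Word k
      at i = to e₁ (from rearrange i)
      label : ∀ i {z} → lookup plain i ≡ z → φ (at i) ≡ just z
      label i iz = cong just (trans (cong s (strictlyInverseʳ e₁ _)) (trans (s-from i) iz))
      π-at : ∀ i → to π (at i) ≡ to e₂ i
      π-at i = cong (to e₂) (trans (cong (to rearrange) (strictlyInverseʳ e₁ _)) (strictlyInverseˡ rearrange i))
      joined : ∀ {u v} → (∃₂ λ p q → Consecutive p q × lookup plain p ≡ u × lookup plain q ≡ v) →
               ∃₂ λ x y → φ x ≡ just u × φ y ≡ just v × TwoCubes π x y
      joined (p , q , c , pu , qv) = at p , at q , label p pu , label q qv
        , inj₂ (subst₂ Adj (sym (π-at p)) (sym (π-at q)) (e₂-adj c))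

  graph-Q : ∀ k l → Fin n → length (edges H) * 2 ≤ 2 ^ k → k * 2 < 2 ^ l → H ≼ Q (2 + (l + k))
  graph-Q k l v₀ fits fits′ = embed (2 + (l + k)) (model-trans adj-sym (proj₂ M) (twoCubes-cube (proj₁ M) fits′))
    where
    M = graph-twoCubes k v₀ fits
    embed : ∀ d → Model (Edge H) (Adj {d}) → H ≼ Q d
    embed d M = model⇒≼ sH (Q-simple d) (model-trans (edge-sym {G = Q d} (Q-simple d)) M (cube-Q d))

-- Choice of the dimensions

power-above : ∀ b → 2 ≤ b → ∀ n → ∃ λ l → suc n ≤ b ^ l × b ^ l < b * suc n
power-above b 2≤b zero = 0 , s≤s z≤n , subst (1 <_) (sym (ℕ.*-identityʳ b)) 2≤b
power-above b@(suc _) 2≤b (suc n) with power-above b 2≤b n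
... | l , lo , hi with ℕ.m≤n⇒m<n∨m≡n lo
...   | inj₁ lt = l , lt , ℕ.<-trans hi (ℕ.*-monoʳ-< b (ℕ.n<1+n (suc n)))
...   | inj₂ eq = suc l
        , subst (λ z → suc (suc n) ≤ b * z) eq (ℕ.≤-trans 2+n≤ (ℕ.*-monoˡ-≤ (suc n) 2≤b))
        , subst (λ z → b * z < b * suc (suc n)) eq (ℕ.*-monoʳ-< b (ℕ.n<1+n (suc n)))
  where
  2+n≤ : suc (suc n) ≤ 2 * suc n
  2+n≤ = s≤s (ℕ.≤-trans (s≤s (ℕ.m≤m+n n 0)) (ℕ.m≤n+m (suc (n + 0)) n))

model-empty : ∀ {m} {H : Graph 0} {G : Graph m} → Model (Edge H) (Edge G)
model-empty = record { φ = λ _ → nothing ; root = λ () ; φ-root = λ () ; conn = λ { {_} {()} } ; edge = λ { {()} } }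

-- With `D = 2 + l + k` the requirements are `2 * e ≤ 2 ^ k` and `2 * k < 2 ^ l`. Taking `2 ^ l`
-- from `2 * D` to below `4 * D` meets the second. The first reads `8 * e * 2 ^ l ≤ 2 ^ D`, which
-- follows from `32 * e * D ≤ 2 ^ D`.
hypercube-universal : ∀ d → 1 ≤ d → MinorUniversal (Q d) (λ e → 32 * e * d ≤ 1 * 2 ^ d)
-- The empty graph offers no vertex for the padding.
hypercube-universal d       1≤d zero    H sH noIso bound = model⇒≼ sH (Q-simple d) model-empty
hypercube-universal (suc d) 1≤d (suc n) H sH noIso bound =
  subst (λ d → H ≼ Q d) d≡ (graph-Q sH noIso k l 0F fits fits′)
  where
  above = power-above 2 ℕ.≤-refl (suc d + d)
  l  = proj₁ above
  lo = proj₁ (proj₂ above)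
  hi = proj₂ (proj₂ above)
  D = suc d
  e = edgeCount H
  k = D ∸ (2 + l)

  e≥1 : 1 ≤ e
  e≥1 = subst (1 ≤_) (length-edges H) (nonempty (∈-edges sH (proj₂ (noIso 0F))))
    where
    nonempty : ∀ {i j} → (i , j) ∈ edges H ⊎ (j , i) ∈ edges H → 1 ≤ length (edges H)
    nonempty (inj₁ m) = ℕ.≤-trans (s≤s z≤n) (Fin.toℕ<n (Any.index m))
    nonempty (inj₂ m) = ℕ.≤-trans (s≤s z≤n) (Fin.toℕ<n (Any.index m))

  2D≡ : 2 * D ≡ suc (suc d + d)
  2D≡ = solve 1 (λ d → con 2 :* (con 1 :+ d) := con 1 :+ (con 1 :+ d :+ d)) refl d

  8e2^l≤ : 8 * e * 2 ^ l ≤ 2 ^ D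
  8e2^l≤ = begin
    8 * e * 2 ^ l           ≤⟨ ℕ.*-monoʳ-≤ (8 * e) (ℕ.<⇒≤ hi) ⟩
    8 * e * (2 * suc (suc d + d)) ≡⟨ cong (λ z → 8 * e * (2 * z)) 2D≡ ⟨
    8 * e * (2 * (2 * D))   ≡⟨ solve 2 (λ e D → con 8 :* e :* (con 2 :* (con 2 :* D)) := con 32 :* e :* D) refl e D ⟩
    32 * e * D              ≤⟨ bound ⟩
    1 * 2 ^ D               ≡⟨ ℕ.*-identityˡ (2 ^ D) ⟩
    2 ^ D                   ∎
    where open ℕ.≤-Reasoning

  -- A single edge already makes `bound` force this, so the truncated subtraction in `k` is exact.
  2+l≤D : 2 + l ≤ D
  2+l≤D = ℕ.≮⇒≥ λ D<2+l → ℕ.<⇒≱ (ℕ.^-monoʳ-< 2 (s≤s (s≤s z≤n)) D<2+l) (begin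
    2 ^ (2 + l)       ≡⟨ solve 1 (λ x → con 2 :* (con 2 :* x) := con 4 :* x) refl (2 ^ l) ⟩
    4 * 2 ^ l         ≤⟨ ℕ.*-monoˡ-≤ (2 ^ l) {4} {8 * 1} (s≤s (s≤s (s≤s (s≤s z≤n)))) ⟩
    8 * 1 * 2 ^ l     ≤⟨ ℕ.*-monoˡ-≤ (2 ^ l) (ℕ.*-monoʳ-≤ 8 e≥1) ⟩
    8 * e * 2 ^ l     ≤⟨ 8e2^l≤ ⟩
    2 ^ D             ∎)
    where open ℕ.≤-Reasoning

  d≡ : 2 + (l + k) ≡ D
  d≡ = ℕ.m+[n∸m]≡n 2+l≤D

  fits : length (edges H) * 2 ≤ 2 ^ k
  fits = ℕ.*-cancelˡ-≤ (4 * 2 ^ l) {{ℕ.m*n≢0 4 (2 ^ l) {{_}} {{ℕ.m^n≢0 2 l}}}} (begin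
    4 * 2 ^ l * (length (edges H) * 2) ≡⟨ cong (λ z → 4 * 2 ^ l * (z * 2)) (length-edges H) ⟩
    4 * 2 ^ l * (e * 2)                ≡⟨ solve 2 (λ x e → con 4 :* x :* (e :* con 2) := con 8 :* e :* x) refl (2 ^ l) e ⟩
    8 * e * 2 ^ l                      ≤⟨ 8e2^l≤ ⟩
    2 ^ D                              ≡⟨ cong (2 ^_) d≡ ⟨
    2 ^ (2 + (l + k))                  ≡⟨ cong (λ z → 2 * (2 * z)) (ℕ.^-distribˡ-+-* 2 l k) ⟩
    2 * (2 * (2 ^ l * 2 ^ k))          ≡⟨ solve 2 (λ x y → con 2 :* (con 2 :* (x :* y)) := con 4 :* x :* y) refl (2 ^ l) (2 ^ k) ⟩
    4 * 2 ^ l * 2 ^ k                  ∎)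
    where open ℕ.≤-Reasoning

  fits′ : k * 2 < 2 ^ l
  fits′ = begin-strict
    k * 2              ≤⟨ ℕ.*-monoˡ-≤ 2 (ℕ.m∸n≤m d (1 + l)) ⟩
    d * 2              ≡⟨ ℕ.*-comm d 2 ⟩
    2 * d              <⟨ ℕ.*-monoʳ-< 2 (ℕ.n<1+n d) ⟩
    2 * D              ≡⟨ 2D≡ ⟩
    suc (suc d + d)    ≤⟨ lo ⟩
    2 ^ l              ∎
    where open ℕ.≤-Reasoning

-- Counting minors

data Same {X : Set} (C : List (X × X)) : X → X → Set where
  base   : ∀ {x y} → (x , y) ∈ C → Same C x y
  srefl  : ∀ {x} → Same C x x
  ssym   : ∀ {x y} → Same C x y → Same C y x
  strans : ∀ {x y z} → Same C x y → Same C y z → Same C x z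

same-map : {X Y : Set} {C : List (X × X)} {C′ : List (Y × Y)} (h : X → Y) →
           (∀ {x y} → (x , y) ∈ C → Same C′ (h x) (h y)) → ∀ {x y} → Same C x y → Same C′ (h x) (h y)
same-map h gen (base m)     = gen m
same-map h gen srefl        = srefl
same-map h gen (ssym s)     = ssym (same-map h gen s)
same-map h gen (strans s t) = strans (same-map h gen s) (same-map h gen t)

same-≡ : {X : Set} {C : List (X × X)} {x y : X} → x ≡ y → Same C x y
same-≡ refl = srefl

Joined : {V X : Set} → List (X × X) → List (X × X) → (V → X) → V → V → Set
Joined C D r i j = ∃₂ λ x y → (x , y) ∈ D ×
  ((Same C x (r i) × Same C y (r j)) ⊎ (Same C x (r j) × Same C y (r i)))

joined-map : {V X Y : Set} {C D : List (X × X)} {r : V → X} {C′ D′ : List (Y × Y)} {r′ : V → Y} →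
  (∀ {x y} → (x , y) ∈ D → ∃₂ λ x′ y′ → (x′ , y′) ∈ D′ ×
     (∀ v → Same C x (r v) → Same C′ x′ (r′ v)) × (∀ v → Same C y (r v) → Same C′ y′ (r′ v))) →
  ∀ {i j} → Joined C D r i j → Joined C′ D′ r′ i j
joined-map f (x , y , m , s) with f m
... | x′ , y′ , m′ , fx , fy = x′ , y′ , m′ , Sum.map (Product.map (fx _) (fy _)) (Product.map (fx _) (fy _)) s

-- By `sound` and `complete`, the first three fields determine `H`, so that counting them bounds the
-- number of labelled minors. Each contraction uses up a vertex of `G`, whence `contracted-≤`.
record Certificate {n m : ℕ} (H : Graph n) (G : Graph m) : Set where
  field
    contracted       : List (Fin m × Fin m)
    kept             : List (Fin m × Fin m)
    rep              : Fin n → Fin m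
    contracted-edges : ∀ {x y} → (x , y) ∈ contracted → Edge G x y
    kept-edges       : ∀ {x y} → (x , y) ∈ kept → Edge G x y
    contracted-≤     : length contracted ≤ m
    kept-≡           : length kept ≡ edgeCount H
    sound            : ∀ {i j} → Joined contracted kept rep i j → Edge H i j
    complete         : ∀ {i j} → Edge H i j → Joined contracted kept rep i j

both : {X Y : Set} → (X → Y) → X × X → Y × Y
both f = Product.map f f

∈-both⁻ : {X Y : Set} (f : X → Y) {xs : List (X × X)} {a b : Y} → (a , b) ∈ map (both f) xs →
          ∃₂ λ x y → (x , y) ∈ xs × a ≡ f x × b ≡ f y
∈-both⁻ f m with ∈-map⁻ (both f) m
... | (x , y) , m′ , refl = x , y , m′ , refl , refl

certificate-≅ : {n : ℕ} {H G : Graph n} → IsSimple H → H ≅ G → Certificate H G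
certificate-≅ {n} {H} {G} sH (σ , same) = record
  { contracted       = []
  ; kept             = map (both (σ ⟨$⟩ʳ_)) (edges H)
  ; rep              = σ ⟨$⟩ʳ_
  ; contracted-edges = λ ()
  ; kept-edges       = kept-edges
  ; contracted-≤     = z≤n
  ; kept-≡           = trans (List.length-map _ (edges H)) (length-edges H)
  ; sound            = sound
  ; complete         = complete
  }
  where
  kept-edges : ∀ {x y} → (x , y) ∈ map (both (σ ⟨$⟩ʳ_)) (edges H) → Edge G x y
  kept-edges m with ∈-both⁻ (σ ⟨$⟩ʳ_) m
  ... | i , j , m′ , refl , refl = trans (sym (same i j)) (∈-edges⁻ m′)
  σ-same : ∀ {x y} → Same [] x y → x ≡ y
  σ-same (base ())
  σ-same srefl        = refl
  σ-same (ssym s)     = sym (σ-same s)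
  σ-same (strans s t) = trans (σ-same s) (σ-same t)
  σ-injective : ∀ {i j} → Same [] (σ ⟨$⟩ʳ i) (σ ⟨$⟩ʳ j) → i ≡ j
  σ-injective s = ⟨$⟩ʳ-injective σ (σ-same s)
  sound : ∀ {i j} → Joined [] (map (both (σ ⟨$⟩ʳ_)) (edges H)) (σ ⟨$⟩ʳ_) i j → Edge H i j
  sound (x , y , m , s) with ∈-both⁻ (σ ⟨$⟩ʳ_) m
  sound (_ , _ , _ , inj₁ (s , t)) | a , b , m′ , refl , refl =
    subst₂ (Edge H) (σ-injective s) (σ-injective t) (∈-edges⁻ m′)
  sound (_ , _ , _ , inj₂ (s , t)) | a , b , m′ , refl , refl =
    edge-sym {G = H} sH (subst₂ (Edge H) (σ-injective s) (σ-injective t) (∈-edges⁻ m′))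
  complete : ∀ {i j} → Edge H i j → Joined [] (map (both (σ ⟨$⟩ʳ_)) (edges H)) (σ ⟨$⟩ʳ_) i j
  complete h with ∈-edges sH h
  ... | inj₁ m = _ , _ , ∈-map⁺ (both (σ ⟨$⟩ʳ_)) m , inj₁ (srefl , srefl)
  ... | inj₂ m = _ , _ , ∈-map⁺ (both (σ ⟨$⟩ʳ_)) m , inj₂ (srefl , srefl)

certificate-deleteVertex : {n m : ℕ} {H : Graph n} {G : Graph (suc m)} (v : Fin (suc m)) →
                           Certificate H (deleteVertex G v) → Certificate H G
certificate-deleteVertex {n} {m} {H} {G} v cert = record
  { contracted       = C′
  ; kept             = D′
  ; rep              = s ∘ rep
  ; contracted-edges = lifted contracted-edges
  ; kept-edges       = lifted kept-edges
  ; contracted-≤     = ℕ.m≤n⇒m≤1+n (subst (_≤ m) (sym (List.length-map _ contracted)) contracted-≤)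
  ; kept-≡           = trans (List.length-map _ kept) kept-≡
  ; sound            = sound ∘ joined-map down
  ; complete         = joined-map up ∘ complete
  }
  where
  open Certificate cert
  s = punchIn v
  C′ = map (both s) contracted
  D′ = map (both s) kept

  lifted : ∀ {E : List (Fin m × Fin m)} → (∀ {x y} → (x , y) ∈ E → Edge (deleteVertex G v) x y) →
           ∀ {x y} → (x , y) ∈ map (both s) E → Edge G x y
  lifted es p with ∈-both⁻ s p
  ... | x , y , p′ , refl , refl = es p′

  same-up : ∀ {x y} → Same contracted x y → Same C′ (s x) (s y)
  same-up = same-map s (base ∘ ∈-map⁺ (both s))

  -- The deleted vertex occurs in no pair of `C′`, so its value `z` is arbitrary.
  retract : Fin m → Fin (suc m) → Fin m
  retract z a with v Fin.≟ a
  ... | yes _  = z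
  ... | no v≢a = punchOut v≢a

  retract-s : ∀ z a → retract z (s a) ≡ a
  retract-s z a with v Fin.≟ s a
  ... | yes p  = contradiction (sym p) (Fin.punchInᵢ≢i v a)
  ... | no v≢a = trans (Fin.punchOut-cong v refl) (Fin.punchOut-punchIn v)

  same-down : ∀ {x y} → Same C′ (s x) (s y) → Same contracted x y
  same-down {x} {y} p = subst₂ (Same contracted) (retract-s x x) (retract-s x y) (same-map (retract x) gen p)
    where
    gen : ∀ {a b} → (a , b) ∈ C′ → Same contracted (retract x a) (retract x b)
    gen q with ∈-both⁻ s q
    ... | a , b , q′ , refl , refl = subst₂ (Same contracted) (sym (retract-s x a)) (sym (retract-s x b)) (base q′)

  up : ∀ {x y} → (x , y) ∈ kept → ∃₂ λ x′ y′ → (x′ , y′) ∈ D′ ×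
       (∀ i → Same contracted x (rep i) → Same C′ x′ (s (rep i))) × (∀ i → Same contracted y (rep i) → Same C′ y′ (s (rep i)))
  up p = _ , _ , ∈-map⁺ (both s) p , (λ _ → same-up) , (λ _ → same-up)

  down : ∀ {x y} → (x , y) ∈ D′ → ∃₂ λ x′ y′ → (x′ , y′) ∈ kept ×
       (∀ i → Same C′ x (s (rep i)) → Same contracted x′ (rep i)) × (∀ i → Same C′ y (s (rep i)) → Same contracted y′ (rep i))
  down p with ∈-both⁻ s p
  ... | x , y , p′ , refl , refl = x , y , p′ , (λ _ → same-down) , (λ _ → same-down)

certificate-contractEdge : {n m : ℕ} {H : Graph n} {G : Graph (suc m)} → IsSimple G →
                           (u v : Fin (suc m)) → Edge G u v →
                           Certificate H (contractEdge G u v) → Certificate H G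
certificate-contractEdge {n} {m} {H} {G} sG u v uv cert = record
  { contracted       = C′
  ; kept             = D′
  ; rep              = s ∘ rep
  ; contracted-edges = λ { (here refl) → uv ; (there p) → Lift.edges′ LC p }
  ; kept-edges       = Lift.edges′ LD
  ; contracted-≤     = s≤s (subst (_≤ m) (trans (cong length (sym (Lift.projects LC))) (List.length-map _ (Lift.list LC))) contracted-≤)
  ; kept-≡           = trans (trans (sym (List.length-map _ D′)) (cong length (Lift.projects LD))) kept-≡
  ; sound            = sound ∘ joined-map down
  ; complete         = joined-map up ∘ complete
  }
  where
  open Certificate cert
  v≢u : v ≢ u
  v≢u refl = contradiction (trans (sym uv) (IsSimple.irrefl sG u)) λ ()
  open Contraction v≢u
  s = punchIn v

  s-proj-u : ∀ {i} → s i ≡ u → proj v ≡ i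
  s-proj-u {i} p = trans proj-v (trans (sym proj-u) (trans (cong proj (sym p)) (proj-punchIn i)))

  -- An edge of the contracted graph comes from an edge of `G` with the same ends, or with `v` in
  -- place of an end `u`.
  lift : ∀ {i j} → Edge (contractEdge G u v) i j → ∃₂ λ a b → Edge G a b × proj a ≡ i × proj b ≡ j
  lift {i} {j} e with not (i == j) | e
  ... | true | e′ with G (s i) (s j) in direct | s i == u in iu | s j == u in ju
  ...   | true  | _ | _ = s i , s j , direct , proj-punchIn i , proj-punchIn j
  ...   | false | true | _ with G v (s j) in vj
  ...     | true = v , s j , vj , s-proj-u (==⇒≡ iu) , proj-punchIn j
  lift {i} {j} e | true | e′ | false | true | true | false =
    s i , v , edge-sym {G = G} sG e′ , proj-punchIn i , s-proj-u (==⇒≡ ju)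
  lift {i} {j} e | true | e′ | false | false | true =
    s i , v , edge-sym {G = G} sG e′ , proj-punchIn i , s-proj-u (==⇒≡ ju)

  record Lift (E : List (Fin m × Fin m)) : Set where
    field
      list     : List (Fin (suc m) × Fin (suc m))
      projects : map (both proj) list ≡ E
      edges′   : ∀ {x y} → (x , y) ∈ list → Edge G x y

  liftAll : ∀ E → (∀ {x y} → (x , y) ∈ E → Edge (contractEdge G u v) x y) → Lift E
  liftAll []            es = record { list = [] ; projects = refl ; edges′ = λ () }
  liftAll ((i , j) ∷ E) es with lift (es (here refl)) | liftAll E (es ∘ there)
  ... | a , b , ab , refl , refl | L = record
    { list     = (a , b) ∷ Lift.list L
    ; projects = cong (_ ∷_) (Lift.projects L)
    ; edges′   = λ { (here refl) → ab ; (there p) → Lift.edges′ L p } }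

  LC = liftAll contracted contracted-edges
  LD = liftAll kept kept-edges
  -- The extra pair glues the only fibre of `proj` that has two points.
  C′ = (u , v) ∷ Lift.list LC
  D′ = Lift.list LD

  same-fibre : ∀ a → Same C′ (s (proj a)) a
  same-fibre a with punchIn-proj a
  ... | inj₁ (refl , p) = strans (same-≡ p) (base (here refl))
  ... | inj₂ p          = same-≡ p

  lifted : ∀ {E} (L : Lift E) {x y} → (x , y) ∈ E → ∃₂ λ a b → (a , b) ∈ Lift.list L × x ≡ proj a × y ≡ proj b
  lifted L p = ∈-both⁻ proj (subst (_ ∈_) (sym (Lift.projects L)) p)

  projected : ∀ {E} (L : Lift E) {a b} → (a , b) ∈ Lift.list L → (proj a , proj b) ∈ E
  projected L p = subst (_ ∈_) (Lift.projects L) (∈-map⁺ (both proj) p)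

  same-up : ∀ {a x} → Same contracted (proj a) x → Same C′ a (s x)
  same-up {a} p = strans (ssym (same-fibre a)) (same-map s gen p)
    where
    gen : ∀ {x y} → (x , y) ∈ contracted → Same C′ (s x) (s y)
    gen q with lifted LC q
    ... | a , b , q′ , refl , refl = strans (same-fibre a) (strans (base (there q′)) (ssym (same-fibre b)))

  same-down : ∀ {a x} → Same C′ a (s x) → Same contracted (proj a) x
  same-down {a} {x} p = subst (Same contracted (proj a)) (proj-punchIn x) (same-map proj gen p)
    where
    gen : ∀ {a b} → (a , b) ∈ C′ → Same contracted (proj a) (proj b)
    gen (here refl) = same-≡ (trans proj-u (sym proj-v))
    gen (there q)   = base (projected LC q)

  up : ∀ {x y} → (x , y) ∈ kept → ∃₂ λ x′ y′ → (x′ , y′) ∈ D′ ×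
       (∀ i → Same contracted x (rep i) → Same C′ x′ (s (rep i))) × (∀ i → Same contracted y (rep i) → Same C′ y′ (s (rep i)))
  up p with lifted LD p
  ... | a , b , p′ , refl , refl = a , b , p′ , (λ _ → same-up) , (λ _ → same-up)

  down : ∀ {x y} → (x , y) ∈ D′ → ∃₂ λ x′ y′ → (x′ , y′) ∈ kept ×
       (∀ i → Same C′ x (s (rep i)) → Same contracted x′ (rep i)) × (∀ i → Same C′ y (s (rep i)) → Same contracted y′ (rep i))
  down p = _ , _ , projected LD p , (λ _ → same-down) , (λ _ → same-down)

certificate : {n m : ℕ} {H : Graph n} {G : Graph m} → IsSimple H → IsSimple G → H ≼ G → Certificate H G
certificate sH sG (done iso)                = certificate-≅ sH iso
certificate sH sG (step (delV G v) p)       = certificate-deleteVertex v (certificate sH (deleteVertex-simple v sG) p)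
certificate sH sG (step (conE G u v uv) p)  =
  certificate-contractEdge sG u v uv (certificate sH (contractEdge-simple u v sG) p)
certificate sH sG (step (delE G u v uv) p)  = record
  { contracted = contracted ; kept = kept ; rep = rep
  ; contracted-edges = undelete ∘ contracted-edges ; kept-edges = undelete ∘ kept-edges
  ; contracted-≤ = contracted-≤ ; kept-≡ = kept-≡ ; sound = sound ; complete = complete }
  where
  open Certificate (certificate sH (deleteEdge-simple u v sG) p)
  undelete : ∀ {x y} → Edge (deleteEdge G u v) x y → Edge G x y
  undelete {x} {y} e with G x y
  ... | true = refl

≼⇒≤ : {n m : ℕ} {H : Graph n} {G : Graph m} → H ≼ G → n ≤ m
≼⇒≤ (done _)                = ℕ.≤-refl
≼⇒≤ (step (delV G v) p)     = ℕ.m≤n⇒m≤1+n (≼⇒≤ p)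
≼⇒≤ (step (delE G u v _) p) = ≼⇒≤ p
≼⇒≤ (step (conE G u v _) p) = ℕ.m≤n⇒m≤1+n (≼⇒≤ p)

-- Encoding lists of hypercube edges

neighbour : ∀ d → Fin (2 ^ d) → Fin d → Fin (2 ^ d)
neighbour d x a = unbits d (Vec.updateAt (bits d x) a not)

adj⇒updateAt : ∀ {d} {v w : Word d} → Adj v w → ∃ λ a → w ≡ Vec.updateAt v a not
adj⇒updateAt flip     = zero , refl
adj⇒updateAt (keep {b = b} p) with adj⇒updateAt p
... | a , eq = suc a , cong (b ∷_) eq

edge⇒neighbour : ∀ d {x y} → Edge (Q d) x y → ∃ λ a → y ≡ neighbour d x a
edge⇒neighbour d {x} {y} e = proj₁ flipped , trans (sym (unbits-bits d y)) (cong (unbits d) (proj₂ flipped))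
  where flipped = adj⇒updateAt (Q-edge⇒adj d {x} {y} e)

-- A sequence of pairs (vertex, direction) grouped by vertex is written as a string in which the
-- letter zero moves on to the next vertex and the letter suc a stands for the direction a.
module _ {d : ℕ} where

  tokens : ∀ {n} → ℕ → Vec (Fin (suc d)) n → List (ℕ × Fin d)
  tokens x []          = []
  tokens x (zero  ∷ w) = tokens (suc x) w
  tokens x (suc a ∷ w) = (x , a) ∷ tokens x w

  separators : ∀ {n} → Vec (Fin (suc d)) n → ℕ
  separators []          = 0
  separators (zero  ∷ w) = suc (separators w)
  separators (suc a ∷ w) = separators w

  insert : ∀ {n} → ℕ → Fin d → Vec (Fin (suc d)) n → Vec (Fin (suc d)) (suc n)
  insert zero    a w           = suc a ∷ w
  -- A default value for strings with too few separators; the hypotheses `x ≤ separators w` below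
  -- exclude it.
  insert (suc x) a []          = suc a ∷ []
  insert (suc x) a (zero  ∷ w) = zero ∷ insert x a w
  insert (suc x) a (suc b ∷ w) = suc b ∷ insert (suc x) a w

  separators-insert : ∀ {n} x a (w : Vec (Fin (suc d)) n) → separators w ≤ separators (insert x a w)
  separators-insert zero    a w           = ℕ.≤-refl
  separators-insert (suc x) a []          = z≤n
  separators-insert (suc x) a (zero  ∷ w) = s≤s (separators-insert x a w)
  separators-insert (suc x) a (suc b ∷ w) = separators-insert (suc x) a w

  ∈-insert⁻ : ∀ {n} x a (w : Vec (Fin (suc d)) n) → x ≤ separators w → ∀ o {z} →
              z ∈ tokens o (insert x a w) → z ≡ (o + x , a) ⊎ z ∈ tokens o w
  ∈-insert⁻ zero    a w           le o (here refl) = inj₁ (cong (_, a) (sym (ℕ.+-identityʳ o)))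
  ∈-insert⁻ zero    a w           le o (there p)   = inj₂ p
  ∈-insert⁻ (suc x) a (zero  ∷ w) (s≤s le) o p with ∈-insert⁻ x a w le (suc o) p
  ... | inj₁ q = inj₁ (trans q (cong (_, a) (sym (ℕ.+-suc o x))))
  ... | inj₂ q = inj₂ q
  ∈-insert⁻ (suc x) a (suc b ∷ w) le o (here refl) = inj₂ (here refl)
  ∈-insert⁻ (suc x) a (suc b ∷ w) le o (there p) with ∈-insert⁻ (suc x) a w le o p
  ... | inj₁ q = inj₁ q
  ... | inj₂ q = inj₂ (there q)

  ∈-insert-new : ∀ {n} x a (w : Vec (Fin (suc d)) n) → x ≤ separators w → ∀ o → (o + x , a) ∈ tokens o (insert x a w)
  ∈-insert-new zero    a w           le       o = here (cong (_, a) (ℕ.+-identityʳ o))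
  ∈-insert-new (suc x) a (zero  ∷ w) (s≤s le) o =
    subst (λ y → (y , a) ∈ tokens (suc o) (insert x a w)) (sym (ℕ.+-suc o x)) (∈-insert-new x a w le (suc o))
  ∈-insert-new (suc x) a (suc b ∷ w) le       o = there (∈-insert-new (suc x) a w le o)

  ∈-insert-old : ∀ {n} x a (w : Vec (Fin (suc d)) n) → x ≤ separators w → ∀ o {z} →
                 z ∈ tokens o w → z ∈ tokens o (insert x a w)
  ∈-insert-old zero    a w           le       o p           = there p
  ∈-insert-old (suc x) a (zero  ∷ w) (s≤s le) o p           = ∈-insert-old x a w le (suc o) p
  ∈-insert-old (suc x) a (suc b ∷ w) le       o (here refl) = here refl
  ∈-insert-old (suc x) a (suc b ∷ w) le       o (there p)   = there (∈-insert-old (suc x) a w le o p)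

  separators-replicate : ∀ n → separators (Vec.replicate n zero) ≡ n
  separators-replicate zero    = refl
  separators-replicate (suc n) = cong suc (separators-replicate n)

  ∉-tokens-replicate : ∀ n o {z} → ¬ z ∈ tokens o (Vec.replicate n zero)
  ∉-tokens-replicate (suc n) o p = ∉-tokens-replicate n (suc o) p

  Decoded : ∀ {n} → Vec (Fin (suc d)) n → Fin (2 ^ d) → Fin (2 ^ d) → Set
  Decoded w x y = ∃ λ a → (toℕ x , a) ∈ tokens 0 w × y ≡ neighbour d x a

  -- The length allows for `2 ^ d` separators and `B` edges; if `E` is shorter than `B`, further
  -- separators fill the string. Order is forgotten, and only membership in `E` is recovered.
  record Encoding (E : List (Fin (2 ^ d) × Fin (2 ^ d))) (B : ℕ) : Set where
    field
      string     : Vec (Fin (suc d)) (B + 2 ^ d)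
      enough     : 2 ^ d ≤ separators string
      encodes    : ∀ {x y} → (x , y) ∈ E → Decoded string x y
      decodes    : ∀ {x y} → Decoded string x y → (x , y) ∈ E

  encode-edges : ∀ E → (∀ {x y} → (x , y) ∈ E → Edge (Q d) x y) → ∀ {B} → length E ≤ B → Encoding E B
  encode-edges [] es {B} _ = record
    { string  = Vec.replicate (B + 2 ^ d) zero
    ; enough  = ℕ.≤-trans (ℕ.m≤n+m (2 ^ d) B) (ℕ.≤-reflexive (sym (separators-replicate (B + 2 ^ d))))
    ; encodes = λ ()
    ; decodes = λ { (a , p , _) → contradiction p (∉-tokens-replicate (B + 2 ^ d) 0) }
    }
  encode-edges ((u , v) ∷ E) es {suc B} (s≤s le) = record
    { string  = insert (toℕ u) a string
    ; enough  = ℕ.≤-trans enough (separators-insert (toℕ u) a string)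
    ; encodes = encodes′
    ; decodes = decodes′
    }
    where
    open Encoding (encode-edges E (es ∘ there) le)
    direction = edge⇒neighbour d {u} {v} (es (here refl))
    a = proj₁ direction
    fits : toℕ u ≤ separators string
    fits = ℕ.≤-trans (ℕ.<⇒≤ (Fin.toℕ<n u)) enough
    encodes′ : ∀ {x y} → (x , y) ∈ (u , v) ∷ E → Decoded (insert (toℕ u) a string) x y
    encodes′ (here refl) = a , ∈-insert-new (toℕ u) a string fits 0 , proj₂ direction
    encodes′ (there p)   = let b , q , r = encodes p in b , ∈-insert-old (toℕ u) a string fits 0 q , r
    decodes′ : ∀ {x y} → Decoded (insert (toℕ u) a string) x y → (x , y) ∈ (u , v) ∷ E
    decodes′ {x} {y} (b , p , r) = cases (∈-insert⁻ (toℕ u) a string fits 0 p)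
      where
      cases : (toℕ x , b) ≡ (toℕ u , a) ⊎ (toℕ x , b) ∈ tokens 0 string → (x , y) ∈ (u , v) ∷ E
      cases (inj₁ q) = here (cong₂ _,_ x≡u (trans r (trans (cong₂ (neighbour d) x≡u (cong proj₂ q)) (sym (proj₂ direction)))))
        where x≡u = Fin.toℕ-injective (cong proj₁ q)
      cases (inj₂ q) = there (decodes (b , q , r))

funToFin-injective : ∀ {b n} (f g : Fin n → Fin b) → funToFin f ≡ funToFin g → ∀ i → f i ≡ g i
funToFin-injective f g p i = trans (sym (Fin.finToFun-funToFin f i))
    (trans (cong (λ z → finToFun z i) p) (Fin.finToFun-funToFin g i))

vecToFin : ∀ {b n} → Vec (Fin b) n → Fin (b ^ n)
vecToFin w = funToFin (Vec.lookup w)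

vecToFin-injective : ∀ {b n} (v w : Vec (Fin b) n) → vecToFin v ≡ vecToFin w → v ≡ w
vecToFin-injective v w p = begin
  v                           ≡⟨ Vec.tabulate∘lookup v ⟨
  Vec.tabulate (Vec.lookup v) ≡⟨ Vec.tabulate-cong (funToFin-injective (Vec.lookup v) (Vec.lookup w) p) ⟩
  Vec.tabulate (Vec.lookup w) ≡⟨ Vec.tabulate∘lookup w ⟩
  w                           ∎
  where open ≡-Reasoning

-- The factors count the strings for at most `2 ^ d` contracted edges, the strings for at most `B`
-- kept edges, and the maps `rep`.
codes : ℕ → ℕ → ℕ → ℕ
codes d B n = suc d ^ (2 ^ d + 2 ^ d) * (suc d ^ (B + 2 ^ d) * (2 ^ d) ^ n)

module _ {d n B : ℕ} where

  module Code {H : Graph n} (sH : IsSimple H) (H≼Q : H ≼ Q d) (small : edgeCount H ≤ B) where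
    open Certificate (certificate sH (Q-simple d) H≼Q) public
    module C = Encoding (encode-edges {d} contracted contracted-edges contracted-≤)
    module D = Encoding (encode-edges {d} kept kept-edges (ℕ.≤-trans (ℕ.≤-reflexive kept-≡) small))

    code : Fin (codes d B n)
    code = combine (vecToFin C.string) (combine (vecToFin D.string) (funToFin rep))

  -- `complete` of the one certificate and `sound` of the other are linked by the equal strings,
  -- which decode to the same pairs.
  code-determines : ∀ {H H′ : Graph n} (sH : IsSimple H) (sH′ : IsSimple H′) (H≼Q : H ≼ Q d) (H′≼Q : H′ ≼ Q d)
                    (small : edgeCount H ≤ B) (small′ : edgeCount H′ ≤ B) →
                    Code.code sH H≼Q small ≡ Code.code sH′ H′≼Q small′ →
                    ∀ {i j} → Edge H i j → Edge H′ i j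
  code-determines sH sH′ H≼Q H′≼Q small small′ eq = N.sound ∘ joined-map transfer ∘ M.complete
    where
    module M = Code sH H≼Q small
    module N = Code sH′ H′≼Q small′
    split = Fin.combine-injective (vecToFin M.C.string) _ (vecToFin N.C.string) _ eq
    split′ = Fin.combine-injective (vecToFin M.D.string) _ (vecToFin N.D.string) _ (proj₂ split)
    C≡ : M.C.string ≡ N.C.string
    C≡ = vecToFin-injective _ _ (proj₁ split)
    D≡ : M.D.string ≡ N.D.string
    D≡ = vecToFin-injective _ _ (proj₁ split′)
    rep≡ : ∀ i → M.rep i ≡ N.rep i
    rep≡ = funToFin-injective M.rep N.rep (proj₂ split′)

    same : ∀ i {x} → Same M.contracted x (M.rep i) → Same N.contracted x (N.rep i)
    same i {x} s = subst (Same N.contracted x) (rep≡ i)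
      (same-map id (λ {x} {y} p → base (N.C.decodes (subst (λ w → Decoded w x y) C≡ (M.C.encodes p)))) s)

    transfer : ∀ {x y} → (x , y) ∈ M.kept → ∃₂ λ x′ y′ → (x′ , y′) ∈ N.kept ×
      (∀ i → Same M.contracted x (M.rep i) → Same N.contracted x′ (N.rep i)) ×
      (∀ i → Same M.contracted y (M.rep i) → Same N.contracted y′ (N.rep i))
    transfer {x} {y} p = x , y , N.D.decodes (subst (λ w → Decoded w x y) D≡ (M.D.encodes p)) , (λ i → same i) , (λ i → same i)

-- Graphs that are not minors

unique⇒lookup-injective : {A : Set} {xs : List A} → Unique xs → ∀ {i j} → lookup xs i ≡ lookup xs j → i ≡ j
unique⇒lookup-injective (_ ∷ _)  {zero}  {zero}  eq = refl
unique⇒lookup-injective (x ∷ _)  {zero}  {suc j} eq = contradiction eq (All.lookup x (∈-lookup j))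
unique⇒lookup-injective (x ∷ _)  {suc i} {zero}  eq = contradiction (sym eq) (All.lookup x (∈-lookup i))
unique⇒lookup-injective (_ ∷ xs) {suc i} {suc j} eq = cong suc (unique⇒lookup-injective xs eq)

module FromList {n : ℕ} (L : List (Fin n × Fin n)) where

  open DecMembership (×.≡-dec {A = Fin n} {B = λ _ → Fin n} Fin._≟_ Fin._≟_) using (_∈?_)

  graph : Graph n
  graph i j = not (i == j) ∧ (⌊ (i , j) ∈? L ⌋ ∨ ⌊ (j , i) ∈? L ⌋)

  graph-simple : IsSimple graph
  graph-simple = record
    { sym    = λ i j → cong₂ _∧_ (cong not (==-comm i j)) (Bool.∨-comm ⌊ (i , j) ∈? L ⌋ _)
    ; irrefl = λ i → cong₂ _∧_ (cong not (==-refl i)) refl }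

  graph⁻ : ∀ {i j} → Edge graph i j → (i , j) ∈ L ⊎ (j , i) ∈ L
  graph⁻ {i} {j} e with not (i == j) | (i , j) ∈? L | (j , i) ∈? L | e
  ... | true | yes p | _     | _  = inj₁ p
  ... | true | no _  | yes p | _  = inj₂ p
  ... | true | no _  | no _  | ()

  graph⁺ : ∀ {i j} → i ≢ j → (i , j) ∈ L → Edge graph i j
  graph⁺ {i} {j} i≢j p rewrite ≢⇒== i≢j with (i , j) ∈? L
  ... | yes _ = refl
  ... | no ¬p = contradiction p ¬p

  edges-unique : Unique (edges graph)
  edges-unique = Unique.filter⁺ _ (Unique.cartesianProduct⁺ (Unique.allFin⁺ n) (Unique.allFin⁺ n))

  edges-ordered : ∀ {i j} → (i , j) ∈ edges graph → i Fin.< j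
  edges-ordered {i} {j} p with graph i j | i Fin.<? j
    | proj₂ (∈-filter⁻ (λ e → isEdge graph e Bool.≟ true) {xs = cartesianProduct (allFin n) (allFin n)} p)
  ... | true | yes i<j | _ = i<j

  source : ∀ p → let (i , j) = lookup (edges graph) p in (i , j) ∈ L ⊎ (j , i) ∈ L
  source p = graph⁻ (∈-edges⁻ {G = graph} (∈-lookup p))

  sourceIndex : Fin (length (edges graph)) → Fin (length L)
  sourceIndex p with source p
  ... | inj₁ m = Any.index m
  ... | inj₂ m = Any.index m

  sourceIndex-lookup : ∀ p → let (i , j) = lookup (edges graph) p in
    lookup L (sourceIndex p) ≡ (i , j) ⊎ lookup L (sourceIndex p) ≡ (j , i)
  sourceIndex-lookup p with source p
  ... | inj₁ m = inj₁ (sym (Any.lookup-index m))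
  ... | inj₂ m = inj₂ (sym (Any.lookup-index m))

  -- An entry of `L` may give an edge in either orientation, but the edges listed are increasing
  -- pairs, so the entry determines the edge.
  sourceIndex-injective : ∀ {p q} → sourceIndex p ≡ sourceIndex q → p ≡ q
  sourceIndex-injective {p} {q} eq = unique⇒lookup-injective edges-unique
    (cases (ordered p) (ordered q) (sourceIndex-lookup p)
      (subst (λ z → lookup L z ≡ e′ ⊎ lookup L z ≡ (proj₂ e′ , proj₁ e′)) (sym eq) (sourceIndex-lookup q)))
    where
    e′ = lookup (edges graph) q
    ordered : ∀ p → proj₁ (lookup (edges graph) p) Fin.< proj₂ (lookup (edges graph) p)
    ordered p = edges-ordered (∈-lookup p)
    cases : ∀ {a b c d : Fin n} {l} → a Fin.< b → c Fin.< d →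
            l ≡ (a , b) ⊎ l ≡ (b , a) → l ≡ (c , d) ⊎ l ≡ (d , c) → (a , b) ≡ (c , d)
    cases a<b c<d (inj₁ refl) (inj₁ refl) = refl
    cases a<b c<d (inj₂ refl) (inj₂ refl) = refl
    cases a<b c<d (inj₁ refl) (inj₂ refl) = contradiction c<d (ℕ.<-asym a<b)
    cases a<b c<d (inj₂ refl) (inj₁ refl) = contradiction c<d (ℕ.<-asym a<b)

  edgeCount-≤ : edgeCount graph ≤ length L
  edgeCount-≤ = subst (_≤ length L) (length-edges graph) (Fin.injective⇒≤ sourceIndex-injective)

module StarGraph (m : ℕ) where

  list : List (Fin (suc (suc m)) × Fin (suc (suc m)))
  list = tabulate (λ j → 0F , suc j)

  open FromList list public

  noIsolated : NoIsolated graph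
  noIsolated zero    = 1F , graph⁺ {0F} {1F} (λ ()) (∈-tabulate⁺ {f = λ j → 0F , suc j} 0F)
  noIsolated (suc j) = 0F , edge-sym {G = graph} graph-simple {0F} {suc j} (graph⁺ {0F} {suc j} (λ ()) (∈-tabulate⁺ {f = λ j → 0F , suc j} j))

  star-edgeCount : edgeCount graph ≤ suc m
  star-edgeCount = subst (edgeCount graph ≤_) (List.length-tabulate {n = suc m} (λ j → 0F , suc j)) edgeCount-≤

funToFin-cong : ∀ {m n} {f g : Fin m → Fin n} → (∀ i → f i ≡ g i) → funToFin f ≡ funToFin g
funToFin-cong {zero}  eq = refl
funToFin-cong {suc m} eq = cong₂ combine (eq 0F) (funToFin-cong (eq ∘ suc))

-- Vertices: a hub, k * s left vertices and k blocks of s right vertices. Every left vertex has one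
-- freely chosen neighbour in every block; the hub is joined to all right vertices.
module Family (k s : ℕ) where

  A = k * s

  order : ℕ
  order = suc (A + A)

  hub : Fin order
  hub = 0F

  left right : Fin A → Fin order
  left i  = suc (i ↑ˡ A)
  right j = suc (A ↑ʳ j)

  choices : (Fin (A * k) → Fin s) → List (Fin order × Fin order)
  choices F = tabulate (λ x → left (proj₁ (remQuot {A} k x)) , right (combine (proj₂ (remQuot {A} k x)) (F x)))

  spokes : List (Fin order × Fin order)
  spokes = tabulate (λ j → hub , right j)

  list : (Fin (A * k) → Fin s) → List (Fin order × Fin order)
  list F = choices F ++ spokes

  module _ (F : Fin (A * k) → Fin s) where
    open FromList (list F) public

  size : ℕ
  size = A * k + A

  length-list : ∀ F → length (list F) ≡ size
  length-list F = trans (List.length-++ (choices F))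
    (cong₂ _+_ (List.length-tabulate _) (List.length-tabulate {n = A} (λ j → hub , right j)))

  edgeCount-family : ∀ F → edgeCount (graph F) ≤ size
  edgeCount-family F = subst (edgeCount (graph F) ≤_) (length-list F) (edgeCount-≤ F)

  left≢right : ∀ {i j} → left i ≢ right j
  left≢right {i} {j} p = contradiction
    (subst (_< A) (trans (sym (Fin.toℕ-↑ˡ i A)) (trans (cong toℕ (Fin.suc-injective p)) (Fin.toℕ-↑ʳ A j))) (Fin.toℕ<n i))
    (ℕ.≤⇒≯ (ℕ.m≤m+n A (toℕ j)))

  choice-edge : ∀ F i l → Edge (graph F) (left i) (right (combine l (F (combine i l))))
  choice-edge F i l = graph⁺ F left≢right (∈-++⁺ˡ (subst (_∈ choices F) eq (∈-tabulate⁺ (combine i l))))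
    where
    eq = cong (λ il → left (proj₁ il) , right (combine (proj₂ il) (F (combine i l)))) (Fin.remQuot-combine i l)

  choice-edge⁻ : ∀ F i l b → Edge (graph F) (left i) (right (combine l b)) → b ≡ F (combine i l)
  choice-edge⁻ F i l b e with graph⁻ F e
  ... | inj₁ m with ∈-++⁻ (choices F) m
  ...   | inj₁ m′ with ∈-tabulate⁻ m′
  ...     | x , eq = trans b≡ (cong F (trans (sym (Fin.combine-remQuot {A} k x)) (cong₂ combine (sym i≡) (sym l≡))))
    where
    i≡ : i ≡ proj₁ (remQuot {A} k x)
    i≡ = Fin.↑ˡ-injective A _ _ (Fin.suc-injective (cong proj₁ eq))
    lb≡ = Fin.combine-injective l b _ (F x) (Fin.↑ʳ-injective A _ _ (Fin.suc-injective (cong proj₂ eq)))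
    l≡ = proj₁ lb≡
    b≡ = proj₂ lb≡
  choice-edge⁻ F i l b e | inj₁ m | inj₂ m′ with ∈-tabulate⁻ m′
  ...     | _ , ()
  choice-edge⁻ F i l b e | inj₂ m with ∈-++⁻ (choices F) m
  ...   | inj₁ m′ = contradiction (sym (cong proj₁ (proj₂ (∈-tabulate⁻ m′)))) left≢right
  ...   | inj₂ m′ with ∈-tabulate⁻ m′
  ...     | _ , ()

  spoke : ∀ F j → Edge (graph F) hub (right j)
  spoke F j = graph⁺ F {hub} {right j} (λ ()) (∈-++⁺ʳ (choices F) (∈-tabulate⁺ j))

  noIsolated : Fin k → Fin s → ∀ F → NoIsolated (graph F)
  noIsolated l₀ b₀ F zero = right (combine l₀ b₀) , spoke F _
  noIsolated l₀ b₀ F (suc y) with Fin.splitAt A y in eq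
  ... | inj₁ i = right j , subst (λ z → Edge (graph F) (suc z) (right j)) (Fin.splitAt⁻¹-↑ˡ eq) (choice-edge F i l₀)
    where j = combine l₀ (F (combine i l₀))
  ... | inj₂ j = hub , subst (λ z → Edge (graph F) (suc z) hub) (Fin.splitAt⁻¹-↑ʳ eq)
          (edge-sym {G = graph F} (graph-simple F) {hub} {right j} (spoke F j))

  -- By `choice-edge⁻` a graph of the family reveals its `F`, so a single inclusion of edge sets
  -- already forces equal choices.
  counting : ∀ d → (∀ F → graph F ≼ Q d) → s ^ (A * k) ≤ codes d size order
  counting d minor = Fin.injective⇒≤ {f = code} code-injective
    where
    module CodeOf (p : Fin (s ^ (A * k))) = Code {d} {order} {size}
      (graph-simple (finToFun p)) (minor (finToFun p)) (edgeCount-family (finToFun p))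
    code : Fin (s ^ (A * k)) → Fin (codes d size order)
    code p = CodeOf.code p
    same : ∀ {p q} → code p ≡ code q → ∀ i l → finToFun p (combine i l) ≡ finToFun {s} {A * k} q (combine i l)
    same {p} {q} eq i l = choice-edge⁻ (finToFun q) i l _
      (code-determines {d} {order} {size}
        (graph-simple (finToFun p)) (graph-simple (finToFun q)) (minor (finToFun p)) (minor (finToFun q))
        (edgeCount-family (finToFun p)) (edgeCount-family (finToFun q)) eq
        {left i} {right (combine l (finToFun p (combine i l)))} (choice-edge (finToFun p) i l))
    code-injective : ∀ {p q} → code p ≡ code q → p ≡ q
    code-injective {p} {q} eq = begin
      p                               ≡⟨ Fin.funToFin-finToFin {A * k} p ⟨
      funToFin (finToFun {s} {A * k} p) ≡⟨ funToFin-cong (λ x → subst (λ x → finToFun p x ≡ finToFun q x)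
                                           (Fin.combine-remQuot {A} k x) (same eq _ _)) ⟩
      funToFin (finToFun {s} {A * k} q) ≡⟨ Fin.funToFin-finToFin {A * k} q ⟩
      q                               ∎
      where open ≡-Reasoning

-- Numerical estimates

square-bound : ∀ {e c s d N} → e ≤ c * s → s * s * d ≤ N → 1 ^ 2 * e ^ 2 * d ≤ c ^ 2 * N
square-bound {e} {c} {s} {d} {N} e≤ ssd≤ = begin
  1 ^ 2 * e ^ 2 * d     ≡⟨ solve 2 (λ e d → con 1 :* (e :* (e :* con 1)) :* d := e :* e :* d) refl e d ⟩
  e * e * d             ≤⟨ ℕ.*-monoˡ-≤ d (ℕ.*-mono-≤ e≤ e≤) ⟩
  c * s * (c * s) * d   ≡⟨ solve 3 (λ c s d → c :* s :* (c :* s) :* d := c :* (c :* con 1) :* (s :* s :* d)) refl c s d ⟩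
  c ^ 2 * (s * s * d)   ≤⟨ ℕ.*-monoʳ-≤ (c ^ 2) ssd≤ ⟩
  c ^ 2 * N             ∎
  where open ℕ.≤-Reasoning

2^d*2^d≡4^d : ∀ d → 2 ^ d * 2 ^ d ≡ 4 ^ d
2^d*2^d≡4^d zero    = refl
2^d*2^d≡4^d (suc d) = trans
  (solve 1 (λ x → con 2 :* x :* (con 2 :* x) := con 4 :* (x :* x)) refl (2 ^ d)) (cong (4 *_) (2^d*2^d≡4^d d))

star-bound : ∀ {e d} → d ≤ 64 → e ≤ 2 ^ d → 1 ^ 2 * e ^ 2 * d ≤ 72 ^ 2 * 4 ^ d
star-bound {e} {d} d≤64 e≤ = begin
  1 ^ 2 * e ^ 2 * d     ≡⟨ solve 2 (λ e d → con 1 :* (e :* (e :* con 1)) :* d := d :* (e :* e)) refl e d ⟩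
  d * (e * e)           ≤⟨ ℕ.*-mono-≤ (ℕ.≤-trans d≤64 (ℕ.≤ᵇ⇒≤ 64 (72 ^ 2) _)) (ℕ.*-mono-≤ e≤ e≤) ⟩
  72 ^ 2 * (2 ^ d * 2 ^ d) ≡⟨ cong (72 ^ 2 *_) (2^d*2^d≡4^d d) ⟩
  72 ^ 2 * 4 ^ d        ∎
  where open ℕ.≤-Reasoning

-- A star on `2 ^ d + 1` vertices has too many vertices to be a minor, and its edges respect the
-- bound since `64 ≤ 72 ^ 2`.
not-universal-small : ∀ d → d ≤ 64 → ¬ MinorUniversal (Q d) (λ e → 1 ^ 2 * e ^ 2 * d ≤ 72 ^ 2 * 4 ^ d)
not-universal-small d d≤64 universal =
  ℕ.<⇒≱ (subst (_< suc (suc m)) N≡ (ℕ.n<1+n (suc m)))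
        (≼⇒≤ (universal (suc (suc m)) graph graph-simple noIsolated
          (star-bound d≤64 (subst (edgeCount graph ≤_) N≡ star-edgeCount))))
  where
  m = pred (2 ^ d)
  N≡ : suc m ≡ 2 ^ d
  N≡ = ℕ.suc-pred (2 ^ d) {{ℕ.m^n≢0 2 d}}
  open StarGraph m

-- At exponent 3 this fails, as 112 exceeds 64; hence the offset 4, and the threshold `64 = 4 ^ 3`
-- between small and large `d`.
4^-growth : ∀ r → 32 * (4 + r) + 16 ≤ 4 ^ (4 + r)
4^-growth zero    = ℕ.≤ᵇ⇒≤ 144 256 _
4^-growth (suc r) = begin
  32 * (4 + suc r) + 16         ≡⟨ solve 1 (λ r → con 32 :* (con 4 :+ (con 1 :+ r)) :+ con 16 := con 32 :* (con 4 :+ r) :+ con 16 :+ con 32) refl r ⟩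
  32 * (4 + r) + 16 + 32        ≤⟨ ℕ.+-mono-≤ (4^-growth r) (ℕ.≤-trans 32≤ (4^-growth r)) ⟩
  4 ^ (4 + r) + 4 ^ (4 + r)     ≤⟨ ℕ.+-monoʳ-≤ (4 ^ (4 + r)) (ℕ.m≤m+n (4 ^ (4 + r)) _) ⟩
  4 ^ (4 + suc r)               ∎
  where
  open ℕ.≤-Reasoning
  32≤ : 32 ≤ 32 * (4 + r) + 16
  32≤ = ℕ.≤-trans (ℕ.m≤m*n 32 (4 + r)) (ℕ.m≤m+n _ 16)

2^-growth : ∀ r → 2 * (4 + r) + 1 ≤ 2 ^ (4 + r)
2^-growth zero    = ℕ.≤ᵇ⇒≤ 9 16 _
2^-growth (suc r) = begin
  2 * (4 + suc r) + 1         ≡⟨ solve 1 (λ r → con 2 :* (con 4 :+ (con 1 :+ r)) :+ con 1 := con 2 :* (con 4 :+ r) :+ con 1 :+ con 2) refl r ⟩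
  2 * (4 + r) + 1 + 2         ≤⟨ ℕ.+-mono-≤ (2^-growth r) (ℕ.≤-trans 2≤ (2^-growth r)) ⟩
  2 ^ (4 + r) + 2 ^ (4 + r)   ≤⟨ ℕ.+-monoʳ-≤ (2 ^ (4 + r)) (ℕ.m≤m+n (2 ^ (4 + r)) 0) ⟩
  2 ^ (4 + suc r)             ∎
  where
  open ℕ.≤-Reasoning
  2≤ : 2 ≤ 2 * (4 + r) + 1
  2≤ = ℕ.≤-trans (ℕ.m≤m*n 2 (4 + r)) (ℕ.m≤m+n _ 1)

module Large (d t : ℕ) (4≤t : 4 ≤ t) (lo : d ≤ 4 ^ t) (hi : 4 ^ t < 4 * d) where

  t≡ : 4 + (t ∸ 4) ≡ t
  t≡ = ℕ.m+[n∸m]≡n 4≤t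

  -- The number of bits allotted to one letter of the strings, by `suc-d≤`.
  β = 2 * t + 1
  N = 2 ^ d

  β≤2^t : β ≤ 2 ^ t
  β≤2^t = subst (λ t → 2 * t + 1 ≤ 2 ^ t) t≡ (2^-growth (t ∸ 4))

  8t+4≤d : 8 * t + 4 ≤ d
  8t+4≤d = ℕ.*-cancelˡ-≤ 4 (begin
    4 * (8 * t + 4)  ≡⟨ solve 1 (λ t → con 4 :* (con 8 :* t :+ con 4) := con 32 :* t :+ con 16) refl t ⟩
    32 * t + 16      ≤⟨ subst (λ t → 32 * t + 16 ≤ 4 ^ t) t≡ (4^-growth (t ∸ 4)) ⟩
    4 ^ t            ≤⟨ ℕ.<⇒≤ hi ⟩
    4 * d            ∎)
    where open ℕ.≤-Reasoning

  8t≤d : 8 * t ≤ d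
  8t≤d = ℕ.≤-trans (ℕ.m≤m+n (8 * t) 4) 8t+4≤d

  t≤d : t ≤ d
  t≤d = ℕ.≤-trans (ℕ.m≤n*m t 8) 8t≤d

  4β≤d : 4 * β ≤ d
  4β≤d = ℕ.≤-trans (ℕ.≤-reflexive (solve 1 (λ t → con 4 :* (con 2 :* t :+ con 1) := con 8 :* t :+ con 4) refl t)) 8t+4≤d

  1≤d : 1 ≤ d
  1≤d = ℕ.≤-trans (s≤s z≤n) (ℕ.≤-trans (ℕ.m≤n+m 4 (8 * t)) 8t+4≤d)

  δ = d ∸ t
  s = 2 ^ δ

  δ+t≡d : δ + t ≡ d
  δ+t≡d = ℕ.m∸n+n≡m t≤d

  1≤s : 1 ≤ s
  1≤s = ℕ.m^n>0 2 δ

  N≡ : N ≡ s * 2 ^ t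
  N≡ = trans (cong (2 ^_) (sym δ+t≡d)) (ℕ.^-distribˡ-+-* 2 δ t)

  ssd≤4^d : s * s * d ≤ 4 ^ d
  ssd≤4^d = begin
    s * s * d                   ≤⟨ ℕ.*-monoʳ-≤ (s * s) lo ⟩
    s * s * 4 ^ t               ≡⟨ cong (s * s *_) (2^d*2^d≡4^d t) ⟨
    s * s * (2 ^ t * 2 ^ t)     ≡⟨ solve 2 (λ s x → s :* s :* (x :* x) := (s :* x) :* (s :* x)) refl s (2 ^ t) ⟩
    s * 2 ^ t * (s * 2 ^ t)     ≡⟨ cong₂ _*_ N≡ N≡ ⟨
    N * N                       ≡⟨ 2^d*2^d≡4^d d ⟩
    4 ^ d                       ∎
    where open ℕ.≤-Reasoning

  suc-d≤ : suc d ≤ 2 ^ β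
  suc-d≤ = begin
    1 + d                     ≤⟨ ℕ.+-mono-≤ (ℕ.m^n>0 4 t) lo ⟩
    4 ^ t + 4 ^ t             ≡⟨ solve 1 (λ x → x :+ x := x :* con 2) refl (4 ^ t) ⟩
    4 ^ t * 2                 ≡⟨ cong (_* 2) (ℕ.^-*-assoc 2 2 t) ⟩
    2 ^ (2 * t) * 2 ^ 1       ≡⟨ ℕ.^-distribˡ-+-* 2 (2 * t) 1 ⟨
    2 ^ β                     ∎
    where open ℕ.≤-Reasoning

  -- Eight blocks give `64 * s` choices of `δ` bits, with `δ` at least seven eighths of `d`, against
  -- `16 * s + 1` representatives of `d` bits.
  open Family 8 s

  exponent : ℕ
  exponent = β * (N + N) + (β * (size + N) + d * order)

  power-≤ : ∀ x → suc d ^ x ≤ 2 ^ (β * x)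
  power-≤ x = ℕ.≤-trans (ℕ.^-monoˡ-≤ x suc-d≤) (ℕ.≤-reflexive (ℕ.^-*-assoc 2 β x))

  codes-≤ : codes d size order ≤ 2 ^ exponent
  codes-≤ = begin
    codes d size order
      ≤⟨ ℕ.*-mono-≤ (power-≤ (N + N)) (ℕ.*-mono-≤ (power-≤ (size + N)) (ℕ.≤-reflexive (ℕ.^-*-assoc 2 d order))) ⟩
    2 ^ (β * (N + N)) * (2 ^ (β * (size + N)) * 2 ^ (d * order))
      ≡⟨ cong (2 ^ (β * (N + N)) *_) (ℕ.^-distribˡ-+-* 2 (β * (size + N)) (d * order)) ⟨
    2 ^ (β * (N + N)) * 2 ^ (β * (size + N) + d * order)
      ≡⟨ ℕ.^-distribˡ-+-* 2 (β * (N + N)) _ ⟨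
    2 ^ exponent ∎
    where open ℕ.≤-Reasoning

  47d<64δ : 47 * d < 64 * δ
  47d<64δ = ℕ.+-cancelʳ-< (64 * t) (47 * d) (64 * δ) (begin-strict
    47 * d + 64 * t        ≡⟨ cong (47 * d +_) (ℕ.*-assoc 8 8 t) ⟩
    47 * d + 8 * (8 * t)   ≤⟨ ℕ.+-monoʳ-≤ (47 * d) (ℕ.*-monoʳ-≤ 8 8t≤d) ⟩
    47 * d + 8 * d         ≡⟨ ℕ.*-distribʳ-+ d 47 8 ⟨
    55 * d                 <⟨ ℕ.*-monoˡ-< d {{>-nonZero 1≤d}} (ℕ.≤ᵇ⇒≤ 56 64 _) ⟩
    64 * d                 ≡⟨ cong (64 *_) δ+t≡d ⟨
    64 * (δ + t)           ≡⟨ ℕ.*-distribˡ-+ 64 δ t ⟩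
    64 * δ + 64 * t        ∎)
    where open ℕ.≤-Reasoning

  -- In units of `s * d`: 12 for the three summands `N` in the string lengths, by
  -- `β * 2 ^ t ≤ 4 * d`; 18 for the letters of `72 * s` kept edges, by `4 * β ≤ d`; 16 for the
  -- representatives of left and right vertices; 1 for the hub. The sum is 47.
  exponent-< : exponent < δ * (8 * s * 8)
  exponent-< = begin-strict
    exponent
      ≡⟨ cong (λ N → β * (N + N) + (β * (size + N) + d * order)) N≡ ⟩
    β * (s * 2 ^ t + s * 2 ^ t) + (β * (size + s * 2 ^ t) + d * order)
      ≡⟨ solve 4 (λ β s x d → β :* (s :* x :+ s :* x) :+
           (β :* ((con 8 :* s :* con 8 :+ con 8 :* s) :+ s :* x) :+ d :* (con 1 :+ (con 8 :* s :+ con 8 :* s)))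
           := s :* (con 3 :* (β :* x)) :+ s :* (con 18 :* (con 4 :* β)) :+ s :* (con 16 :* d) :+ con 1 :* d)
           refl β s (2 ^ t) d ⟩
    s * (3 * (β * 2 ^ t)) + s * (18 * (4 * β)) + s * (16 * d) + 1 * d
      ≤⟨ ℕ.+-mono-≤ (ℕ.+-monoˡ-≤ (s * (16 * d)) (ℕ.+-mono-≤ (ℕ.*-monoʳ-≤ s (ℕ.*-monoʳ-≤ 3 β2^t≤)) (ℕ.*-monoʳ-≤ s (ℕ.*-monoʳ-≤ 18 4β≤d)))) (ℕ.*-monoˡ-≤ d 1≤s) ⟩
    s * (3 * (4 * d)) + s * (18 * d) + s * (16 * d) + s * d
      ≡⟨ solve 2 (λ s d → s :* (con 3 :* (con 4 :* d)) :+ s :* (con 18 :* d) :+ s :* (con 16 :* d) :+ s :* d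
           := s :* (con 47 :* d)) refl s d ⟩
    s * (47 * d)
      <⟨ ℕ.*-monoʳ-< s {{>-nonZero 1≤s}} 47d<64δ ⟩
    s * (64 * δ)
      ≡⟨ solve 2 (λ s δ → s :* (con 64 :* δ) := δ :* (con 8 :* s :* con 8)) refl s δ ⟩
    δ * (8 * s * 8) ∎
    where
    open ℕ.≤-Reasoning
    β2^t≤ : β * 2 ^ t ≤ 4 * d
    β2^t≤ = ℕ.≤-trans (ℕ.*-monoˡ-≤ (2 ^ t) β≤2^t) (ℕ.≤-trans (ℕ.≤-reflexive (2^d*2^d≡4^d t)) (ℕ.<⇒≤ hi))

  size≡ : size ≡ 72 * s
  size≡ = solve 1 (λ s → con 8 :* s :* con 8 :+ con 8 :* s := con 72 :* s) refl s

  not-universal : ¬ MinorUniversal (Q d) (λ e → 1 ^ 2 * e ^ 2 * d ≤ 72 ^ 2 * 4 ^ d)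
  not-universal universal = ℕ.<⇒≱ too-many (counting d minor)
    where
    minor : ∀ F → graph F ≼ Q d
    minor F = universal order (graph F) (graph-simple F) (noIsolated 0F (Fin.fromℕ< 1≤s) F)
      (square-bound {c = 72} {s} (ℕ.≤-trans (edgeCount-family F) (ℕ.≤-reflexive size≡)) ssd≤4^d)
    too-many : codes d size order < s ^ (8 * s * 8)
    too-many = begin-strict
      codes d size order      ≤⟨ codes-≤ ⟩
      2 ^ exponent            <⟨ ℕ.^-monoʳ-< 2 (s≤s (s≤s z≤n)) exponent-< ⟩
      2 ^ (δ * (8 * s * 8))   ≡⟨ ℕ.^-*-assoc 2 δ (8 * s * 8) ⟨
      s ^ (8 * s * 8)         ∎
      where open ℕ.≤-Reasoning

hypercube-not-universal : ∀ d → 1 ≤ d → ¬ MinorUniversal (Q d) (λ e → 1 ^ 2 * e ^ 2 * d ≤ 72 ^ 2 * 4 ^ d)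
hypercube-not-universal (suc d) _ with suc d ℕ.≤? 64 | power-above 4 (s≤s (s≤s z≤n)) d
... | yes small | _            = not-universal-small (suc d) small
-- From `64 < suc d ≤ 4 ^ t` it follows that `t` exceeds 3.
... | no  large | t , lo , hi  = Large.not-universal (suc d) t (ℕ.≮⇒≥ λ t<4 →
  large (ℕ.≤-trans lo (ℕ.^-monoʳ-≤ 4 (ℕ.≤-pred t<4)))) lo hi

theoremA : (∃ λ (p : ℕ) → ∃ λ (q : ℕ) → 0 < p ×
    (∀ (d : ℕ) → 1 ≤ d →
    MinorUniversal (Q d) (λ e → suc q * e * d ≤ p * 2 ^ d)))
    ×
    (∃ λ (p : ℕ) → ∃ λ (q : ℕ) → 0 < p ×
    (∀ (d : ℕ) → 1 ≤ d →
    ¬ MinorUniversal (Q d) (λ e → suc q ^ 2 * e ^ 2 * d ≤ p ^ 2 * 4 ^ d)))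
theoremA = (1 , 31 , s≤s z≤n , hypercube-universal) , (72 , 0 , s≤s z≤n , hypercube-not-universal)
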